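{- Let $G=(V(G),E(G))$ be a connected signed graph with at least $2$ vertices and at least one negative cycle, and let $t\geq 1$ be an integer. If there exists an edge set $F_0\subseteq E(G)$ with $|E(G)|-|F_0|<t\cdot b(F_0)$, then $ar_{\pm}(G,t)=|E(G)|$. Otherwise, $$ar_{\pm}(G,t)=\max_{F\colon b(F)\geq 2}\{|F|+t\,(b(F)-1)\},$$ where the maximum is taken over all edge sets $F\subseteq E(G)$ with $b(F)\geq 2$.
   Context: A signed graph is a multigraph in which each edge has sign $+$ or $-$; a cycle is positive or negative according to the product of the signs of its edges. A subgraph is balanced if every cycle in it is positive. For $F\subseteq E(G)$, $b(F)$ is the number of balanced connected components of the spanning subgraph $(V(G),F)$ (isolated vertices count as balanced components). A signed unicyclic subgraph is a spanning subgraph of $G$ each of whose connected components contains exactly one cycle, and that cycle is negative. Given a coloring of $E(G)$, a subgraph is rainbow if its edges have pairwise distinct colors. $ar_{\pm}(G,t)$ is the maximum number $m$ such that there is a coloring of $E(G)$ with exactly $m$ colors containing no $t$ pairwise edge-disjoint rainbow signed unicyclic subgraphs. -}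

module Defs where

open import Data.Nat using (ℕ; zero; suc; _+_; _*_; _∸_; _%_; _≤_; _<_)
open import Data.Fin using (Fin; zero; suc; inject₁; fromℕ)
open import Data.Fin.Subset using (Subset; _∈_; ∣_∣; ⊤)
open import Data.Bool using (Bool; true; false; if_then_else_)
open import Data.List using (List; map; allFin)
open import Data.Nat.ListAction using (sum)
open import Data.Product using (Σ; ∃; _×_; _,_)
open import Data.Sum using (_⊎_)
open import Relation.Nullary using (¬_)
open import Relation.Binary.PropositionalEquality using (_≡_)
open import Function using (Injective)
open import Function.Bundles using (_⇔_)

-- A finite signed multigraph (loops and parallel edges allowed).
-- Vertices: Fin n, edges: Fin m; edge e has endpoints ends e;
-- neg e ≡ true means edge e has sign −, false means sign +.
record SGraph : Set where
  field
    n    : ℕ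
    m    : ℕ
    ends : Fin m → Fin n × Fin n
    neg  : Fin m → Bool

EdgeSet : SGraph → Set
EdgeSet G = Subset (SGraph.m G)

module _ (G : SGraph) where
  open SGraph G

  Vtx : Set
  Vtx = Fin n

  Edge : Set
  Edge = Fin m

  Joins : Edge → Vtx → Vtx → Set
  Joins e u v = (ends e ≡ (u , v)) ⊎ (ends e ≡ (v , u))

  data Conn (F : EdgeSet G) : Vtx → Vtx → Set where
    here : ∀ {u} → Conn F u u
    step : ∀ {u w v} (e : Edge) → e ∈ F → Joins e u w → Conn F w v → Conn F u v

  -- A cycle of length suc k: distinct vertices v₀,…,v_k and distinct edges
  -- e₀,…,e_k with eᵢ joining vᵢ and vᵢ₊₁ (indices mod k+1).
  -- (Length 1 = loop, length 2 = pair of parallel edges.)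
  record Cycle : Set where
    field
      len   : ℕ
      vs    : Fin (suc len) → Vtx
      es    : Fin (suc len) → Edge
      vs-inj : Injective _≡_ _≡_ vs
      es-inj : Injective _≡_ _≡_ es
      joins  : (i : Fin len) → Joins (es (inject₁ i)) (vs (inject₁ i)) (vs (suc i))
      closes : Joins (es (fromℕ len)) (vs (fromℕ len)) (vs zero)

  open Cycle

  negCount : Cycle → ℕ
  negCount C = sum (map (λ i → if neg (es C i) then 1 else 0) (allFin (suc (len C))))

  -- sign of a cycle = product of edge signs
  PositiveCycle : Cycle → Set
  PositiveCycle C = negCount C % 2 ≡ 0

  NegativeCycle : Cycle → Set
  NegativeCycle C = negCount C % 2 ≡ 1

  CycleIn : EdgeSet G → Cycle → Set
  CycleIn F C = ∀ i → es C i ∈ F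

  CycleInCompOf : EdgeSet G → Vtx → Cycle → Set
  CycleInCompOf F v C = CycleIn F C × Σ (Fin (suc (len C))) (λ i → Conn F v (vs C i))

  _∈ₑ_ : Edge → Cycle → Set
  e ∈ₑ C = Σ (Fin (suc (len C))) (λ i → es C i ≡ e)

  SameEdges : Cycle → Cycle → Set
  SameEdges C D = ∀ e → (e ∈ₑ C) ⇔ (e ∈ₑ D)

  BalancedComp : EdgeSet G → Vtx → Set
  BalancedComp F v = ∀ C → CycleInCompOf F v C → PositiveCycle C

  -- b(F) ≡ k : (V(G), F) has exactly k balanced connected components
  -- (witnessed by k representatives, one from each balanced component).
  BCount : EdgeSet G → ℕ → Set
  BCount F k = Σ (Fin k → Vtx) λ r →
      (∀ i j → Conn F (r i) (r j) → i ≡ j)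
    × (∀ i → BalancedComp F (r i))
    × (∀ v → BalancedComp F v → Σ (Fin k) λ i → Conn F v (r i))

  -- signed unicyclic spanning subgraph with edge set U: every component contains
  -- exactly one cycle (cycles identified by edge set), and that cycle is negative.
  SignedUnicyclic : EdgeSet G → Set
  SignedUnicyclic U =
      (∀ v → Σ Cycle λ C → CycleInCompOf U v C)
    × (∀ v C D → CycleInCompOf U v C → CycleInCompOf U v D → SameEdges C D)
    × (∀ C → CycleIn U C → NegativeCycle C)

  Connected : Set
  Connected = ∀ u v → Conn ⊤ u v

  HasNegativeCycle : Set
  HasNegativeCycle = Σ Cycle NegativeCycle

  Coloring : ℕ → Set
  Coloring p = Σ (Edge → Fin p) λ c → ∀ x → Σ Edge λ e → c e ≡ x

  Rainbow : ∀ {p} → (Edge → Fin p) → EdgeSet G → Set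
  Rainbow c U = ∀ e e' → e ∈ U → e' ∈ U → c e ≡ c e' → e ≡ e'

  HasTDisjointRainbowSUS : ∀ {p} → (Edge → Fin p) → ℕ → Set
  HasTDisjointRainbowSUS c t = Σ (Fin t → EdgeSet G) λ U →
      (∀ i → SignedUnicyclic (U i) × Rainbow c (U i))
    × (∀ i j e → e ∈ U i → e ∈ U j → i ≡ j)

  Admissible : ℕ → ℕ → Set
  Admissible t p = Σ (Coloring p) λ c → ¬ HasTDisjointRainbowSUS (Data.Product.proj₁ c) t

  IsAr : ℕ → ℕ → Set
  IsAr t X = Admissible t X × (∀ p → Admissible t p → p ≤ X)

  IsMaxFormula : ℕ → ℕ → Set
  IsMaxFormula t X =
      (Σ (EdgeSet G) λ F → Σ ℕ λ k → BCount F k × 2 ≤ k × X ≡ ∣ F ∣ + t * (k ∸ 1))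
    × (∀ F k → BCount F k → 2 ≤ k → ∣ F ∣ + t * (k ∸ 1) ≤ X)

{-# OPTIONS --safe #-}
module Submission where

-- The function F ↦ n − b(F) is the rank function of the signed-graphic matroid, whose bases are the signed
-- unicyclic subgraphs as soon as G is connected and unbalanced. The statement then holds for every matroid
-- of rank ρ ≥ 2.
--
-- Lower bound: every basis has at least b(F) elements outside F. So no t disjoint bases exist when
-- |E ∖ F₀| < t b(F₀). Otherwise give all of F and t (b(F) − 1) − 1 further edges private colours, and one common
-- colour to the rest: a rainbow basis needs at least b(F) − 1 of the privately coloured edges outside F.
--
-- Upper bound: for a colouring with more colours, Rado's theorem for t-fold unions of the matroid yields a
-- rainbow set of more than t (ρ − 1) elements which is a union of t independent sets. It extends to a
-- union of t disjoint bases, and so these bases carry more than t (ρ − 1) colours altogether. If one of them repeats a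
-- colour, then by counting some other basis has no colour in common with it, and a symmetric exchange between
-- the two strictly increases the total number of colours seen by the individual bases. Hence repeating
-- this makes all t bases rainbow.

open import Defs
open import Data.Bool using (Bool; true; false; not; if_then_else_; _xor_; _∨_)
open import Data.Bool.Properties using (xor-assoc; xor-comm; xor-same; ∨-zeroʳ)
import Data.Bool.Properties as Boolₚ
open import Data.Empty using (⊥-elim)
open import Data.Fin using (Fin; zero; suc; combine; remQuot; punchIn; punchOut; inject₁; fromℕ)
open import Data.Fin.Properties using (any?; all?; injective⇒≤; remQuot-combine; combine-injectiveʳ; punchIn-injective; punchInᵢ≢i; punchIn-punchOut)
import Data.Fin.Properties as Finₚ
open import Data.Fin.Subset
open import Data.Fin.Subset.Properties
open import Data.List using (map; allFin)
import Data.List.Properties as Listₚ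
open import Data.Nat using (ℕ; zero; suc; _+_; _*_; _∸_; _%_; _≤_; _<_; z≤n; s≤s; _≤?_; _<?_)
open import Data.Nat.ListAction using (sum)
open import Data.Nat.Properties
open import Data.Nat.Tactic.RingSolver using (solve-∀)
open import Data.Product using (Σ; ∃; _×_; _,_; proj₁; proj₂)
open import Data.Sum using (_⊎_; inj₁; inj₂; [_,_]′)
open import Data.Unit using (tt) renaming (⊤ to Unit)
open import Data.Vec using ([]; _∷_; here; there; tabulate)
open import Data.Vec.Properties using (lookup⇒[]=; []=⇒lookup; lookup∘tabulate)
open import Data.Vec.Properties.WithK using ([]=-irrelevant)
open import Function using (_∘_; id; Injective)
open import Function.Bundles using (mk⇔)
open import Relation.Binary.PropositionalEquality hiding (J)
open import Relation.Nullary using (¬_; Dec; yes; no; does; contradiction)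
open import Relation.Nullary.Decidable using (dec-true; _×-dec_; ¬?; decidable-stable)

-- Both packing steps rest on conditions of one shape: `s ≤ t * rk F + N F` for all `F`. If `N F`
-- counts the elements outside `F` and `s` is `t ρ`, this is Edmonds' condition for `t` disjoint
-- bases; since `rk F + b F ≡ ρ`, it is the negation of the first alternative of the theorem. If
-- `N F` counts the colours outside `F` and `s` is `t (ρ − 1) + 1`, it is Rado's condition for the
-- rainbow set. At most `∣ F ∣` colours occur inside `F`, so for `b(F) ≥ 2` it follows from
-- `p > ∣ F ∣ + t (b(F) − 1)`; for `b(F) ≤ 1` it follows from `1 ≤ t` and Edmonds' condition, which
-- is why the maximum runs over `b(F) ≥ 2` only. The obstacle is that the rainbow set is in general
-- smaller than `t` bases and completing it may repeat colours. Only the number of colours on the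
-- union survives, and exchanges keep it because they keep the union. The rank axioms come from a
-- signed union-find structure: inserting an edge lowers `b` by one exactly when the edge is not
-- spanned, and spanning is monotone in the edge set, which gives submodularity.

private variable
  n p t : ℕ

-- Finite sets

module _ {P : Fin n → Set} (P? : ∀ x → Dec (P x)) where

  abstract
    comprehension : Subset n
    comprehension = tabulate (does ∘ P?)

    ∈-comprehension⁺ : ∀ {x} → P x → x ∈ comprehension
    ∈-comprehension⁺ {x} px = lookup⇒[]= x _ (trans (lookup∘tabulate _ x) (dec-true (P? x) px))

    ∈-comprehension⁻ : ∀ {x} → x ∈ comprehension → P x
    ∈-comprehension⁻ {x} x∈ with P? x | trans (sym (lookup∘tabulate (does ∘ P?) x)) ([]=⇒lookup x∈)
    ... | yes px | _ = px
    ... | no _   | ()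

x∈p─q⁻ : ∀ {x} (p q : Subset n) → x ∈ p ─ q → x ∈ p × x ∉ q
x∈p─q⁻ {x = zero}  (true  ∷ p) (true  ∷ q) ()
x∈p─q⁻ {x = zero}  (true  ∷ p) (false ∷ q) here = here , λ ()
x∈p─q⁻ {x = zero}  (false ∷ p) (true  ∷ q) ()
x∈p─q⁻ {x = zero}  (false ∷ p) (false ∷ q) ()
x∈p─q⁻ {x = suc _} (_     ∷ p) (_     ∷ q) (there x∈) with x∈p─q⁻ p q x∈
... | a , b = there a , λ { (there y) → b y }

x∈p-y⁻ : ∀ {x y} (p : Subset n) → x ∈ p - y → x ∈ p × x ≢ y
x∈p-y⁻ {y = y} p x∈ with x∈p─q⁻ p ⁅ y ⁆ x∈
... | a , b = a , x∉⁅y⁆⇒x≢y b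

∣p∪q∣+∣p∩q∣≡∣p∣+∣q∣ : (p q : Subset n) → ∣ p ∪ q ∣ + ∣ p ∩ q ∣ ≡ ∣ p ∣ + ∣ q ∣
∣p∪q∣+∣p∩q∣≡∣p∣+∣q∣ [] [] = refl
∣p∪q∣+∣p∩q∣≡∣p∣+∣q∣ (true ∷ p) (true ∷ q) =
  cong suc (trans (+-suc _ _) (trans (cong suc (∣p∪q∣+∣p∩q∣≡∣p∣+∣q∣ p q)) (sym (+-suc _ _))))
∣p∪q∣+∣p∩q∣≡∣p∣+∣q∣ (true ∷ p) (false ∷ q) = cong suc (∣p∪q∣+∣p∩q∣≡∣p∣+∣q∣ p q)
∣p∪q∣+∣p∩q∣≡∣p∣+∣q∣ (false ∷ p) (true ∷ q) =
  trans (cong suc (∣p∪q∣+∣p∩q∣≡∣p∣+∣q∣ p q)) (sym (+-suc _ _))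
∣p∪q∣+∣p∩q∣≡∣p∣+∣q∣ (false ∷ p) (false ∷ q) = ∣p∪q∣+∣p∩q∣≡∣p∣+∣q∣ p q

∣p∩q∣+∣p─q∣≡∣p∣ : (p q : Subset n) → ∣ p ∩ q ∣ + ∣ p ─ q ∣ ≡ ∣ p ∣
∣p∩q∣+∣p─q∣≡∣p∣ [] [] = refl
∣p∩q∣+∣p─q∣≡∣p∣ (true ∷ p) (true ∷ q) = cong suc (∣p∩q∣+∣p─q∣≡∣p∣ p q)
∣p∩q∣+∣p─q∣≡∣p∣ (true ∷ p) (false ∷ q) = trans (+-suc _ _) (cong suc (∣p∩q∣+∣p─q∣≡∣p∣ p q))
∣p∩q∣+∣p─q∣≡∣p∣ (false ∷ p) (true ∷ q) = ∣p∩q∣+∣p─q∣≡∣p∣ p q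
∣p∩q∣+∣p─q∣≡∣p∣ (false ∷ p) (false ∷ q) = ∣p∩q∣+∣p─q∣≡∣p∣ p q

∣p∪q∣≤∣p∣+∣q∣ : (p q : Subset n) → ∣ p ∪ q ∣ ≤ ∣ p ∣ + ∣ q ∣
∣p∪q∣≤∣p∣+∣q∣ p q = ≤-trans (m≤m+n _ _) (≤-reflexive (∣p∪q∣+∣p∩q∣≡∣p∣+∣q∣ p q))

∣p∣≤∣q∣+∣p─q∣ : (p q : Subset n) → ∣ p ∣ ≤ ∣ q ∣ + ∣ p ─ q ∣
∣p∣≤∣q∣+∣p─q∣ p q = ≤-trans (≤-reflexive (sym (∣p∩q∣+∣p─q∣≡∣p∣ p q))) (+-monoˡ-≤ _ (∣p∩q∣≤∣q∣ p q))

x∉p⇒∣p∪⁅x⁆∣≡1+∣p∣ : ∀ {x} (p : Subset n) → x ∉ p → ∣ p ∪ ⁅ x ⁆ ∣ ≡ suc ∣ p ∣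
x∉p⇒∣p∪⁅x⁆∣≡1+∣p∣ {n} {x} p x∉p = begin
  ∣ p ∪ ⁅ x ⁆ ∣                    ≡⟨ +-identityʳ _ ⟨
  ∣ p ∪ ⁅ x ⁆ ∣ + 0                ≡⟨ cong (∣ p ∪ ⁅ x ⁆ ∣ +_) (trans (cong ∣_∣ empty) (∣⊥∣≡0 n)) ⟨
  ∣ p ∪ ⁅ x ⁆ ∣ + ∣ p ∩ ⁅ x ⁆ ∣    ≡⟨ ∣p∪q∣+∣p∩q∣≡∣p∣+∣q∣ p ⁅ x ⁆ ⟩
  ∣ p ∣ + ∣ ⁅ x ⁆ ∣                ≡⟨ cong (∣ p ∣ +_) (∣⁅x⁆∣≡1 x) ⟩
  ∣ p ∣ + 1                        ≡⟨ +-comm _ 1 ⟩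
  suc ∣ p ∣                        ∎
  where
  open ≡-Reasoning
  empty : p ∩ ⁅ x ⁆ ≡ ⊥
  empty = Empty-unique λ { (y , y∈) → let y∈p , y∈x = x∈p∩q⁻ p ⁅ x ⁆ y∈ in
    x∉p (subst (_∈ p) (x∈⁅y⁆⇒x≡y x y∈x) y∈p) }

x∈p⇒[p-x]∪⁅x⁆≡p : ∀ {x} (p : Subset n) → x ∈ p → (p - x) ∪ ⁅ x ⁆ ≡ p
x∈p⇒[p-x]∪⁅x⁆≡p {x = x} p x∈p = ⊆-antisym ⊆₁ ⊆₂
  where
  ⊆₁ : (p - x) ∪ ⁅ x ⁆ ⊆ p
  ⊆₁ y∈ with x∈p∪q⁻ (p - x) ⁅ x ⁆ y∈
  ... | inj₁ a = proj₁ (x∈p-y⁻ p a)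
  ... | inj₂ b = subst (_∈ p) (sym (x∈⁅y⁆⇒x≡y x b)) x∈p
  ⊆₂ : p ⊆ (p - x) ∪ ⁅ x ⁆
  ⊆₂ {y} y∈ with y Finₚ.≟ x
  ... | yes refl = q⊆p∪q (p - x) _ (x∈⁅x⁆ x)
  ... | no y≢x = p⊆p∪q _ (x∈p∧x≢y⇒x∈p-y y∈ y≢x)

x∉p-x : ∀ {x} (p : Subset n) → x ∉ p - x
x∉p-x p x∈ = proj₂ (x∈p-y⁻ p x∈) refl

x∈p⇒1+∣p-x∣≡∣p∣ : ∀ {x} (p : Subset n) → x ∈ p → suc ∣ p - x ∣ ≡ ∣ p ∣
x∈p⇒1+∣p-x∣≡∣p∣ {x = x} p x∈p =
  trans (sym (x∉p⇒∣p∪⁅x⁆∣≡1+∣p∣ (p - x) (x∉p-x p))) (cong ∣_∣ (x∈p⇒[p-x]∪⁅x⁆≡p p x∈p))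

∪-⊆ : {p q s : Subset n} → p ⊆ s → q ⊆ s → p ∪ q ⊆ s
∪-⊆ {p = p} {q} p⊆s q⊆s x∈ = [ p⊆s , q⊆s ]′ (x∈p∪q⁻ p q x∈)

x∈p⇒⁅x⁆⊆p : ∀ {x} {p : Subset n} → x ∈ p → ⁅ x ⁆ ⊆ p
x∈p⇒⁅x⁆⊆p {x = x} {p} x∈p y∈ = subst (_∈ p) (sym (x∈⁅y⁆⇒x≡y x y∈)) x∈p

∪-monoˡ-⊆ : {p q : Subset n} (s : Subset n) → p ⊆ q → p ∪ s ⊆ q ∪ s
∪-monoˡ-⊆ {q = q} s p⊆q = ∪-⊆ (λ x∈ → p⊆p∪q s (p⊆q x∈)) (q⊆p∪q q s)

∁-─ : (p : Subset n) → ⊤ ─ p ≡ ∁ p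
∁-─ p = ⊆-antisym (λ x∈ → x∉p⇒x∈∁p (proj₂ (x∈p─q⁻ ⊤ p x∈)))
                  (λ x∈ → x∈p∧x∉q⇒x∈p─q ∈⊤ (x∈∁p⇒x∉p x∈))

subset-induction : (P : Subset n → Set) → P ⊥ → (∀ F e → e ∉ F → P F → P (F ∪ ⁅ e ⁆)) → ∀ F → P F
subset-induction P P⊥ insertion F = go ∣ F ∣ F ≤-refl
  where
  go : ∀ k F → ∣ F ∣ ≤ k → P F
  go k F F≤k with nonempty? F
  ... | no ¬F = subst P (sym (Empty-unique ¬F)) P⊥
  go zero    F F≤k | yes (e , e∈F) = ⊥-elim (n≮0 (<-≤-trans (x∈p⇒∣p-x∣<∣p∣ e∈F) F≤k))
  go (suc k) F F≤k | yes (e , e∈F) = subst P (x∈p⇒[p-x]∪⁅x⁆≡p F e∈F)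
    (insertion (F - e) e (x∉p-x F) (go k (F - e) (≤-pred (<-≤-trans (x∈p⇒∣p-x∣<∣p∣ e∈F) F≤k))))

∈-index : ∀ (A : Subset n) {x} → x ∈ A → Fin ∣ A ∣
∈-index (true  ∷ A) here       = zero
∈-index (true  ∷ A) (there x∈) = suc (∈-index A x∈)
∈-index (false ∷ A) (there x∈) = ∈-index A x∈

∈-index-injective : ∀ (A : Subset n) {x y} (x∈ : x ∈ A) (y∈ : y ∈ A) → ∈-index A x∈ ≡ ∈-index A y∈ → x ≡ y
∈-index-injective (true  ∷ A) here       here       _  = refl
∈-index-injective (true  ∷ A) (there x∈) (there y∈) eq = cong suc (∈-index-injective A x∈ y∈ (Finₚ.suc-injective eq))
∈-index-injective (false ∷ A) (there x∈) (there y∈) eq = cong suc (∈-index-injective A x∈ y∈ eq)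

∈-index-surjective : ∀ (A : Subset n) (i : Fin ∣ A ∣) → Σ (Fin n) λ x → Σ (x ∈ A) λ x∈ → ∈-index A x∈ ≡ i
∈-index-surjective (true  ∷ A) zero    = zero , here , refl
∈-index-surjective (true  ∷ A) (suc i) with ∈-index-surjective A i
... | x , x∈ , eq = suc x , there x∈ , cong suc eq
∈-index-surjective (false ∷ A) i with ∈-index-surjective A i
... | x , x∈ , eq = suc x , there x∈ , eq

-- `f` may depend on the membership proof, because images are often read off from witnesses.
-- Injectivity is still asked of elements only: membership proofs are irrelevant.
∣∣-injection : (A : Subset n) (B : Subset p) (f : ∀ {x} → x ∈ A → Fin p) → (∀ {x} (x∈ : x ∈ A) → f x∈ ∈ B) →
  (∀ {x y} (x∈ : x ∈ A) (y∈ : y ∈ A) → f x∈ ≡ f y∈ → x ≡ y) → ∣ A ∣ ≤ ∣ B ∣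
∣∣-injection A B f f∈ f-inj = injective⇒≤ {f = g} g-inj
  where
  g : Fin ∣ A ∣ → Fin ∣ B ∣
  g i = ∈-index B (f∈ (proj₁ (proj₂ (∈-index-surjective A i))))
  g-inj : Injective _≡_ _≡_ g
  g-inj {i} {j} eq with ∈-index-surjective A i | ∈-index-surjective A j
  ... | x , x∈ , refl | y , y∈ , refl with f-inj x∈ y∈ (∈-index-injective B (f∈ x∈) (f∈ y∈) eq)
  ... | refl = cong (∈-index A) ([]=-irrelevant x∈ y∈)

superset-of-size : (F : Subset n) (k : ℕ) → ∣ F ∣ ≤ k → k ≤ n → Σ (Subset n) λ A → F ⊆ A × ∣ A ∣ ≡ k
superset-of-size [] zero _ _ = [] , id , refl
superset-of-size (true ∷ F) (suc k) (s≤s a) (s≤s b) with superset-of-size F k a b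
... | A , F⊆A , eq = true ∷ A , in⊆in F⊆A , cong suc eq
superset-of-size {suc n} (false ∷ F) k a b with k ≤? n
... | yes k≤n with superset-of-size F k a k≤n
...   | A , F⊆A , eq = false ∷ A , out⊆ F⊆A , eq
superset-of-size {suc n} (false ∷ F) k a b | no k≰n with ≤-antisym b (≰⇒> k≰n)
... | refl = ⊤ , ⊆⊤ , ∣⊤∣≡n (suc n)

-- Finite sums, coverings and packings

sumᶠ : (Fin t → ℕ) → ℕ
sumᶠ {zero}  f = 0
sumᶠ {suc t} f = f zero + sumᶠ (f ∘ suc)

sumᶠ-mono-≤ : {f g : Fin t → ℕ} → (∀ i → f i ≤ g i) → sumᶠ f ≤ sumᶠ g
sumᶠ-mono-≤ {zero}  h = z≤n
sumᶠ-mono-≤ {suc t} h = +-mono-≤ (h zero) (sumᶠ-mono-≤ (h ∘ suc))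

sumᶠ-const : ∀ t (k : ℕ) → sumᶠ {t} (λ _ → k) ≡ t * k
sumᶠ-const zero    k = refl
sumᶠ-const (suc t) k = cong (k +_) (sumᶠ-const t k)

sumᶠ-mono-< : {f g : Fin t → ℕ} → (∀ i → f i ≤ g i) → (i : Fin t) → f i < g i → sumᶠ f < sumᶠ g
sumᶠ-mono-< h zero    lt = +-mono-<-≤ lt (sumᶠ-mono-≤ (h ∘ suc))
sumᶠ-mono-< h (suc i) lt = +-mono-≤-< (h zero) (sumᶠ-mono-< (h ∘ suc) i lt)

sumᶠ-saturated : {f : Fin t → ℕ} (k : ℕ) → (∀ i → f i ≤ k) → t * k ≤ sumᶠ f → ∀ i → f i ≡ k
sumᶠ-saturated {t} {f} k f≤ tk≤ i with m≤n⇒m<n∨m≡n (f≤ i)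
... | inj₂ eq = eq
... | inj₁ lt = contradiction tk≤ (<⇒≱ (<-≤-trans (sumᶠ-mono-< f≤ i lt) (≤-reflexive (sumᶠ-const t k))))

∣∣≤sumᶠ-cover : (X : Subset n) (D : Fin t → Subset n) → (∀ {x} → x ∈ X → ∃ λ i → x ∈ D i) →
  ∣ X ∣ ≤ sumᶠ (λ i → ∣ D i ∣)
∣∣≤sumᶠ-cover {n} {zero} X D cov =
  ≤-reflexive (trans (cong ∣_∣ (Empty-unique λ { (x , x∈) → Finₚ.¬Fin0 (proj₁ (cov x∈)) })) (∣⊥∣≡0 n))
∣∣≤sumᶠ-cover {t = suc t} X D cov =
  ≤-trans (∣p∣≤∣q∣+∣p─q∣ X (D zero)) (+-monoʳ-≤ _ (∣∣≤sumᶠ-cover (X ─ D zero) (D ∘ suc) cov′))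
  where
  cov′ : ∀ {x} → x ∈ X ─ D zero → ∃ λ i → x ∈ D (suc i)
  cov′ x∈ with x∈p─q⁻ X (D zero) x∈
  ... | x∈X , x∉D with cov x∈X
  ... | zero  , x∈D = contradiction x∈D x∉D
  ... | suc i , x∈D = i , x∈D

Disjoint : (Fin t → Subset n) → Set
Disjoint D = ∀ i j x → x ∈ D i → x ∈ D j → i ≡ j

sumᶠ-disjoint≤∣∣ : (X : Subset n) (D : Fin t → Subset n) → (∀ i → D i ⊆ X) → Disjoint D →
  sumᶠ (λ i → ∣ D i ∣) ≤ ∣ X ∣
sumᶠ-disjoint≤∣∣ {t = zero} X D D⊆ dis = z≤n
sumᶠ-disjoint≤∣∣ {t = suc t} X D D⊆ dis = begin
  ∣ D zero ∣ + sumᶠ (λ i → ∣ D (suc i) ∣)  ≤⟨ +-mono-≤ (p⊆q⇒∣p∣≤∣q∣ λ x∈ → x∈p∩q⁺ (D⊆ zero x∈ , x∈))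
                                               (sumᶠ-disjoint≤∣∣ (X ─ D zero) (D ∘ suc)
                                                 (λ i x∈ → x∈p∧x∉q⇒x∈p─q (D⊆ (suc i) x∈) λ x∈₀ → Finₚ.0≢1+n (dis zero (suc i) _ x∈₀ x∈))
                                                 (λ i j x a b → Finₚ.suc-injective (dis (suc i) (suc j) x a b))) ⟩
  ∣ X ∩ D zero ∣ + ∣ X ─ D zero ∣          ≡⟨ ∣p∩q∣+∣p─q∣≡∣p∣ X (D zero) ⟩
  ∣ X ∣                                    ∎
  where
  open ≤-Reasoning

-- Colour sets and rainbow sets

module Image (c : Fin n → Fin p) where

  inImage? : (S : Subset n) (x : Fin p) → Dec (∃ λ e → e ∈ S × c e ≡ x)
  inImage? S x = any? λ e → (e ∈? S) ×-dec (c e Finₚ.≟ x)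

  abstract
    image : Subset n → Subset p
    image S = comprehension (inImage? S)

    ∈-image⁺ : ∀ {S e} → e ∈ S → c e ∈ image S
    ∈-image⁺ {S} {e} e∈ = ∈-comprehension⁺ (inImage? S) (e , e∈ , refl)

    ∈-image⁻ : ∀ {S x} → x ∈ image S → ∃ λ e → e ∈ S × c e ≡ x
    ∈-image⁻ {S} = ∈-comprehension⁻ (inImage? S)

  image-mono : ∀ {S T} → S ⊆ T → image S ⊆ image T
  image-mono S⊆T x∈ with ∈-image⁻ x∈
  ... | e , e∈ , refl = ∈-image⁺ (S⊆T e∈)

  RainbowOn : Subset n → Set
  RainbowOn S = ∀ e f → e ∈ S → f ∈ S → c e ≡ c f → e ≡ f

  ∣image∣≤∣∣ : ∀ S → ∣ image S ∣ ≤ ∣ S ∣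
  ∣image∣≤∣∣ S = ∣∣-injection (image S) S (λ x∈ → proj₁ (∈-image⁻ x∈)) (λ x∈ → proj₁ (proj₂ (∈-image⁻ x∈)))
    λ x∈ y∈ eq → trans (sym (proj₂ (proj₂ (∈-image⁻ x∈)))) (trans (cong c eq) (proj₂ (proj₂ (∈-image⁻ y∈))))

  rainbow⇒∣∣≤∣image∣ : ∀ S → RainbowOn S → ∣ S ∣ ≤ ∣ image S ∣
  rainbow⇒∣∣≤∣image∣ S rb = ∣∣-injection S (image S) (λ {x} _ → c x) ∈-image⁺ (λ x∈ y∈ → rb _ _ x∈ y∈)

  rainbow? : ∀ S → RainbowOn S ⊎ (∃ λ e → ∃ λ f → e ∈ S × f ∈ S × c e ≡ c f × e ≢ f)
  rainbow? S with any? (λ e → any? (λ f → (e ∈? S) ×-dec (f ∈? S) ×-dec (c e Finₚ.≟ c f) ×-dec ¬? (e Finₚ.≟ f)))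
  ... | yes w = inj₂ w
  ... | no ¬w = inj₁ λ e f e∈ f∈ eq → decidable-stable (e Finₚ.≟ f) λ e≢f → ¬w (e , f , e∈ , f∈ , eq , e≢f)

-- Matroids

Submodular : (Subset n → ℕ) → Set
Submodular g = ∀ A B → g (A ∪ B) + g (A ∩ B) ≤ g A + g B

allSubsets? : {P : Subset n → Set} → (∀ F → Dec (P F)) → (∀ F → P F) ⊎ ∃ λ F → ¬ P F
allSubsets? P? with anySubset? (λ F → ¬? (P? F))
... | yes w = inj₂ w
... | no ¬w = inj₁ λ F → decidable-stable (P? F) λ ¬P → ¬w (F , ¬P)

-- Rado's theorem for a submodular function

module _ (c : Fin n → Fin p) (g : Subset n → ℕ) (g-sub : Submodular g) (s : ℕ) where
  open Image c

  -- Rado's condition. On a rainbow `S` colours may be counted as elements, and the condition says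
  -- that `S` has rank at least `s` in the matroid induced by `g`. It is applied to a direct sum
  -- rank and to `t * r F`; the latter is in general not a rank function, hence the arbitrary
  -- submodular `g`.
  Abundant : Subset n → Set
  Abundant S = ∀ F → s ≤ g F + ∣ image (S ─ F) ∣

  abundant? : ∀ S → Abundant S ⊎ ∃ λ F → ¬ (s ≤ g F + ∣ image (S ─ F) ∣)
  abundant? S = allSubsets? λ F → s ≤? g F + ∣ image (S ─ F) ∣

  -- If the colour of `e` were still seen outside `F`, deleting `e` would lose no colour there, and
  -- the deficit at `F` would already be present in `S`.
  missing-colour : ∀ {S e F} → Abundant S → ¬ (s ≤ g F + ∣ image ((S - e) ─ F) ∣) → c e ∉ image ((S - e) ─ F)
  missing-colour {S} {e} {F} ab ¬ab ce∈ = ¬ab (≤-trans (ab F) (+-monoʳ-≤ (g F) (p⊆q⇒∣p∣≤∣q∣ incl)))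
    where
    incl : image (S ─ F) ⊆ image ((S - e) ─ F)
    incl x∈ with ∈-image⁻ x∈
    ... | d , d∈ , refl with d Finₚ.≟ e
    ... | yes refl = ce∈
    ... | no d≢e with x∈p─q⁻ S F d∈
    ... | d∈S , d∉F = ∈-image⁺ (x∈p∧x∉q⇒x∈p─q (x∈p∧x≢y⇒x∈p-y d∈S d≢e) d∉F)

  -- Uncrossing: the two deficits add up to at least two. Passing to `F₁ ∪ F₂` and `F₁ ∩ F₂`, the
  -- only colour counted beyond `P` and `Q` is the common colour of `e` and `f`, which makes up for
  -- one of them but not for both.
  not-both-deficient : ∀ {S e f F₁ F₂} → Abundant S → e ≢ f → c e ≡ c f →
    ¬ (s ≤ g F₁ + ∣ image ((S - e) ─ F₁) ∣) → ¬ (s ≤ g F₂ + ∣ image ((S - f) ─ F₂) ∣) → Data.Empty.⊥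
  not-both-deficient {S} {e} {f} {F₁} {F₂} ab e≢f ce≡cf ¬ab₁ ¬ab₂ = 1+n≰n (begin
    suc (suc ((g F₁ + ∣ P ∣) + (g F₂ + ∣ Q ∣)))     ≡⟨ +-suc (suc (g F₁ + ∣ P ∣)) _ ⟨
    suc (g F₁ + ∣ P ∣) + suc (g F₂ + ∣ Q ∣)         ≤⟨ +-mono-≤ (≰⇒> ¬ab₁) (≰⇒> ¬ab₂) ⟩
    s + s                                           ≤⟨ +-mono-≤ (ab (F₁ ∪ F₂)) (ab (F₁ ∩ F₂)) ⟩
    (g (F₁ ∪ F₂) + ∣ image (S ─ (F₁ ∪ F₂)) ∣) + (g (F₁ ∩ F₂) + ∣ image (S ─ (F₁ ∩ F₂)) ∣)
      ≤⟨ +-mono-≤ (+-monoʳ-≤ (g (F₁ ∪ F₂)) (p⊆q⇒∣p∣≤∣q∣ ⊆∩)) (+-monoʳ-≤ (g (F₁ ∩ F₂)) ≤∪) ⟩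
    (g (F₁ ∪ F₂) + ∣ P ∩ Q ∣) + (g (F₁ ∩ F₂) + suc ∣ P ∪ Q ∣)
      ≡⟨ shuffle₁ (g (F₁ ∪ F₂)) _ (g (F₁ ∩ F₂)) _ ⟩
    suc ((g (F₁ ∪ F₂) + g (F₁ ∩ F₂)) + (∣ P ∪ Q ∣ + ∣ P ∩ Q ∣))
      ≤⟨ s≤s (+-mono-≤ (g-sub F₁ F₂) (≤-reflexive (∣p∪q∣+∣p∩q∣≡∣p∣+∣q∣ P Q))) ⟩
    suc ((g F₁ + g F₂) + (∣ P ∣ + ∣ Q ∣))           ≡⟨ cong suc (shuffle₂ (g F₁) _ _ _) ⟩
    suc ((g F₁ + ∣ P ∣) + (g F₂ + ∣ Q ∣))           ∎)
    where
    open ≤-Reasoning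
    P = image ((S - e) ─ F₁)
    Q = image ((S - f) ─ F₂)
    shuffle₁ : ∀ a b c d → (a + b) + (c + suc d) ≡ suc ((a + c) + (d + b))
    shuffle₁ = solve-∀
    shuffle₂ : ∀ a b c d → (a + b) + (c + d) ≡ (a + c) + (b + d)
    shuffle₂ = solve-∀
    e∉P : c e ∉ P
    e∉P = missing-colour ab ¬ab₁
    f∉Q : c f ∉ Q
    f∉Q = missing-colour ab ¬ab₂
    ∈P : ∀ {d} → d ∈ S → d ∉ F₁ → d ≢ e → c d ∈ P
    ∈P d∈S d∉F d≢e = ∈-image⁺ (x∈p∧x∉q⇒x∈p─q (x∈p∧x≢y⇒x∈p-y d∈S d≢e) d∉F)
    ∈Q : ∀ {d} → d ∈ S → d ∉ F₂ → d ≢ f → c d ∈ Q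
    ∈Q d∈S d∉F d≢f = ∈-image⁺ (x∈p∧x∉q⇒x∈p─q (x∈p∧x≢y⇒x∈p-y d∈S d≢f) d∉F)
    -- The missing colours force `e ∈ F₂` and `f ∈ F₁`, so neither element survives outside the
    -- union.
    ⊆∩ : image (S ─ (F₁ ∪ F₂)) ⊆ P ∩ Q
    ⊆∩ x∈ with ∈-image⁻ x∈
    ... | d , d∈ , refl with x∈p─q⁻ S (F₁ ∪ F₂) d∈
    ... | d∈S , d∉F with d Finₚ.≟ e | d Finₚ.≟ f
    ... | yes refl | _ = ⊥-elim (f∉Q (subst (_∈ Q) ce≡cf (∈Q d∈S (d∉F ∘ q⊆p∪q F₁ F₂) e≢f)))
    ... | no _ | yes refl = ⊥-elim (e∉P (subst (_∈ P) (sym ce≡cf) (∈P d∈S (d∉F ∘ p⊆p∪q F₂) (e≢f ∘ sym))))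
    ... | no d≢e | no d≢f = x∈p∩q⁺ (∈P d∈S (d∉F ∘ p⊆p∪q F₂) d≢e , ∈Q d∈S (d∉F ∘ q⊆p∪q F₁ F₂) d≢f)
    ⊆∪ : image (S ─ (F₁ ∩ F₂)) ⊆ (P ∪ Q) ∪ ⁅ c e ⁆
    ⊆∪ x∈ with ∈-image⁻ x∈
    ... | d , d∈ , refl with x∈p─q⁻ S (F₁ ∩ F₂) d∈
    ... | d∈S , d∉F with d Finₚ.≟ e | d Finₚ.≟ f
    ... | yes refl | _ = q⊆p∪q (P ∪ Q) _ (x∈⁅x⁆ (c e))
    ... | no _ | yes refl = q⊆p∪q (P ∪ Q) _ (subst (_∈ ⁅ c e ⁆) ce≡cf (x∈⁅x⁆ (c e)))
    ... | no d≢e | no d≢f with d ∈? F₁ | d ∈? F₂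
    ... | no d∉ | _ = p⊆p∪q _ (p⊆p∪q Q (∈P d∈S d∉ d≢e))
    ... | yes _ | no d∉ = p⊆p∪q _ (q⊆p∪q P Q (∈Q d∈S d∉ d≢f))
    ... | yes d∈₁ | yes d∈₂ = contradiction (x∈p∩q⁺ (d∈₁ , d∈₂)) d∉F
    ≤∪ : ∣ image (S ─ (F₁ ∩ F₂)) ∣ ≤ suc ∣ P ∪ Q ∣
    ≤∪ = ≤-trans (p⊆q⇒∣p∣≤∣q∣ ⊆∪) (≤-trans (∣p∪q∣≤∣p∣+∣q∣ (P ∪ Q) ⁅ c e ⁆)
           (≤-reflexive (trans (cong (∣ P ∪ Q ∣ +_) (∣⁅x⁆∣≡1 (c e))) (+-comm _ 1))))

  -- Welsh's proof of Rado's theorem: of two elements of the same colour, one can always be discarded.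
  rainbow-abundant : ∀ S → Abundant S → Σ (Subset n) λ S′ → S′ ⊆ S × Abundant S′ × RainbowOn S′
  rainbow-abundant S = go ∣ S ∣ S ≤-refl
    where
    go : ∀ k S → ∣ S ∣ ≤ k → Abundant S → Σ (Subset n) λ S′ → S′ ⊆ S × Abundant S′ × RainbowOn S′
    shrink : ∀ k S x → x ∈ S → ∣ S ∣ ≤ k → Abundant (S - x) → Σ (Subset n) λ S′ → S′ ⊆ S × Abundant S′ × RainbowOn S′
    go k S S≤k ab with rainbow? S
    ... | inj₁ rb = S , id , ab , rb
    ... | inj₂ (e , f , e∈ , f∈ , ce≡cf , e≢f) with abundant? (S - e) | abundant? (S - f)
    ... | inj₁ ab′ | _ = shrink k S e e∈ S≤k ab′
    ... | inj₂ _ | inj₁ ab′ = shrink k S f f∈ S≤k ab′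
    ... | inj₂ (F₁ , ¬ab₁) | inj₂ (F₂ , ¬ab₂) = ⊥-elim (not-both-deficient ab e≢f ce≡cf ¬ab₁ ¬ab₂)
    shrink zero S x x∈ S≤k ab = ⊥-elim (n≮0 (<-≤-trans (x∈p⇒∣p-x∣<∣p∣ x∈) S≤k))
    shrink (suc k) S x x∈ S≤k ab with go k (S - x) (≤-pred (<-≤-trans (x∈p⇒∣p-x∣<∣p∣ x∈) S≤k)) ab
    ... | S′ , S′⊆ , rest = S′ , (λ y∈ → proj₁ (x∈p-y⁻ S (S′⊆ y∈))) , rest

record IsRankFunction (r : Subset n → ℕ) : Set where
  field
    mono       : ∀ {A B} → A ⊆ B → r A ≤ r B
    submodular : Submodular r
    bounded    : ∀ A → r A ≤ ∣ A ∣

-- Unions of `t` independent sets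

module Matroid {m : ℕ} (r : Subset m → ℕ) (isRank : IsRankFunction r) where
  open IsRankFunction isRank

  module Union (t : ℕ) where

    -- By the matroid partition theorem, these are the unions of t independent sets.
    UnionIndependent : Subset m → Set
    UnionIndependent X = ∀ J → J ⊆ X → ∣ J ∣ ≤ t * r J

    independent-or-violated : ∀ X → UnionIndependent X ⊎ ∃ λ J → J ⊆ X × t * r J < ∣ J ∣
    independent-or-violated X with anySubset? (λ J → (J ⊆? X) ×-dec (t * r J <? ∣ J ∣))
    ... | yes w = inj₂ w
    ... | no ¬w = inj₁ λ J J⊆X → ≮⇒≥ λ lt → ¬w (J , J⊆X , lt)

    unionIndependent? : ∀ X → Dec (UnionIndependent X)
    unionIndependent? X with independent-or-violated X
    ... | inj₁ u = yes u
    ... | inj₂ (J , J⊆ , lt) = no λ u → <⇒≱ lt (u J J⊆)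

    -- For a union-independent `X` the reverse inequality always holds, so this is equality: `X`
    -- uses up the whole capacity `t * r F` of `F`, and no element of `F` outside `X` can be added.
    Tight : Subset m → Subset m → Set
    Tight X F = t * r F ≤ ∣ F ∩ X ∣

    tight-⊥ : ∀ X → Tight X ⊥
    tight-⊥ X = ≤-trans (≤-reflexive (trans (cong (t *_) (n≤0⇒n≡0 (≤-trans (bounded ⊥) (≤-reflexive (∣⊥∣≡0 m))))) (*-zeroʳ t))) z≤n

    -- Submodularity bounds the capacities of union and intersection together. Since `X` is
    -- union-independent, its part in `A ∩ B` fits the capacity there, so all the slack is excluded
    -- from the union.
    tight-∪ : ∀ {X} A B → UnionIndependent X → Tight X A → Tight X B → Tight X (A ∪ B)
    tight-∪ {X} A B ui tA tB = +-cancelʳ-≤ (t * r (A ∩ B)) _ _ (begin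
      t * r (A ∪ B) + t * r (A ∩ B)             ≡⟨ *-distribˡ-+ t _ _ ⟨
      t * (r (A ∪ B) + r (A ∩ B))               ≤⟨ *-monoʳ-≤ t (submodular A B) ⟩
      t * (r A + r B)                           ≡⟨ *-distribˡ-+ t _ _ ⟩
      t * r A + t * r B                         ≤⟨ +-mono-≤ tA tB ⟩
      ∣ A ∩ X ∣ + ∣ B ∩ X ∣                     ≡⟨ ∣p∪q∣+∣p∩q∣≡∣p∣+∣q∣ (A ∩ X) (B ∩ X) ⟨
      ∣ A ∩ X ∪ B ∩ X ∣ + ∣ (A ∩ X) ∩ (B ∩ X) ∣ ≤⟨ +-mono-≤ (≤-reflexive (cong ∣_∣ (sym (∩-distribʳ-∪ X A B))))
                                                     (≤-trans (ui _ (λ x∈ → p∩q⊆q A X (p∩q⊆p _ _ x∈)))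
                                                              (*-monoʳ-≤ t (mono incl))) ⟩
      ∣ (A ∪ B) ∩ X ∣ + t * r (A ∩ B)           ∎)
      where
      open ≤-Reasoning
      incl : (A ∩ X) ∩ (B ∩ X) ⊆ A ∩ B
      incl x∈ with x∈p∩q⁻ (A ∩ X) (B ∩ X) x∈
      ... | a , b = x∈p∩q⁺ (p∩q⊆p A X a , p∩q⊆p B X b)

    -- A violating set must contain the new element, and without it loses just one element. The
    -- strict violation thus becomes tightness with respect to `X`.
    tight-singleton : ∀ {X e J} → UnionIndependent X → J ⊆ X ∪ ⁅ e ⁆ → t * r J < ∣ J ∣ → e ∈ J × Tight X J
    tight-singleton {X} {e} {J} ui J⊆ lt = e∈J , ≤-pred (begin-strict
        t * r J                  <⟨ lt ⟩
        ∣ J ∣                    ≤⟨ p⊆q⇒∣p∣≤∣q∣ incl ⟩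
        ∣ J ∩ X ∪ ⁅ e ⁆ ∣        ≤⟨ ∣p∪q∣≤∣p∣+∣q∣ (J ∩ X) ⁅ e ⁆ ⟩
        ∣ J ∩ X ∣ + ∣ ⁅ e ⁆ ∣    ≡⟨ trans (cong (∣ J ∩ X ∣ +_) (∣⁅x⁆∣≡1 e)) (+-comm _ 1) ⟩
        suc ∣ J ∩ X ∣            ∎)
      where
      open ≤-Reasoning
      incl : J ⊆ J ∩ X ∪ ⁅ e ⁆
      incl x∈ with x∈p∪q⁻ X ⁅ e ⁆ (J⊆ x∈)
      ... | inj₁ a = p⊆p∪q _ (x∈p∩q⁺ (x∈ , a))
      ... | inj₂ b = q⊆p∪q (J ∩ X) _ b
      e∈J : e ∈ J
      e∈J with e ∈? J
      ... | yes e∈ = e∈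
      ... | no e∉ = ⊥-elim (<⇒≱ lt (ui J λ {x} x∈ → [ id , (λ x∈e → ⊥-elim (e∉ (subst (_∈ J) (x∈⁅y⁆⇒x≡y e x∈e) x∈))) ]′
                                               (x∈p∪q⁻ X ⁅ e ⁆ (J⊆ x∈))))

    tight-cover : ∀ {X} → UnionIndependent X → ∀ D → (∀ e → e ∈ D → ∃ λ F → e ∈ F × Tight X F) → ∃ λ F → D ⊆ F × Tight X F
    tight-cover {X} ui = subset-induction _ (λ _ → ⊥ , id , tight-⊥ X) insertion
      where
      insertion : ∀ D e → e ∉ D → ((∀ d → d ∈ D → ∃ λ F → d ∈ F × Tight X F) → ∃ λ F → D ⊆ F × Tight X F) →
        (∀ d → d ∈ D ∪ ⁅ e ⁆ → ∃ λ F → d ∈ F × Tight X F) → ∃ λ F → (D ∪ ⁅ e ⁆) ⊆ F × Tight X F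
      insertion D e _ ih h with ih (λ d d∈ → h d (p⊆p∪q _ d∈)) | h e (q⊆p∪q D _ (x∈⁅x⁆ e))
      ... | F₁ , D⊆ , t₁ | F₂ , e∈ , t₂ = F₁ ∪ F₂ ,
        ∪-⊆ (λ x∈ → p⊆p∪q F₂ (D⊆ x∈)) (λ x∈ → q⊆p∪q F₁ F₂ (x∈p⇒⁅x⁆⊆p e∈ x∈)) , tight-∪ F₁ F₂ ui t₁ t₂

    -- Greedy augmentation. When it stops, each remaining element of `S` lies in a tight set, and
    -- the union `F` of these is tight. At this `F` the hypothesis turns into
    -- `s ≤ ∣ F ∩ X ∣ + ∣ X ─ F ∣`, because everything in `S` outside `F` already belongs to `X`.
    extend : ∀ S s → (∀ F → s ≤ t * r F + ∣ S ─ F ∣) → ∀ X → X ⊆ S → UnionIndependent X →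
      Σ (Subset m) λ X′ → X ⊆ X′ × X′ ⊆ S × UnionIndependent X′ × s ≤ ∣ X′ ∣
    extend S s hyp X X⊆S ui = go ∣ S ─ X ∣ X ≤-refl X⊆S ui
      where
      go : ∀ k X → ∣ S ─ X ∣ ≤ k → X ⊆ S → UnionIndependent X →
        Σ (Subset m) λ X′ → X ⊆ X′ × X′ ⊆ S × UnionIndependent X′ × s ≤ ∣ X′ ∣
      go k X S─X≤k X⊆S ui with any? (λ e → (e ∈? (S ─ X)) ×-dec unionIndependent? (X ∪ ⁅ e ⁆))
      go zero X S─X≤k X⊆S ui | yes (e , e∈ , ui′) =
        ⊥-elim (n≮0 (<-≤-trans (x∈p⇒∣p-x∣<∣p∣ e∈) S─X≤k))
      go (suc k) X S─X≤k X⊆S ui | yes (e , e∈ , ui′)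
        with go k (X ∪ ⁅ e ⁆) (≤-pred (≤-trans (≤-trans (s≤s (≤-reflexive (cong ∣_∣ (sym (p─q─r≡p─q∪r S X ⁅ e ⁆))))) (x∈p⇒∣p-x∣<∣p∣ e∈)) S─X≤k))
                  (∪-⊆ X⊆S (x∈p⇒⁅x⁆⊆p (proj₁ (x∈p─q⁻ S X e∈)))) ui′
      ... | X′ , X⊆X′ , rest = X′ , (λ x∈ → X⊆X′ (p⊆p∪q _ x∈)) , rest
      go k X S─X≤k X⊆S ui | no ¬w with tight-cover ui (S ─ X) (λ e e∈ → local e e∈ (independent-or-violated (X ∪ ⁅ e ⁆)))
        where
        local : ∀ e → e ∈ S ─ X → UnionIndependent (X ∪ ⁅ e ⁆) ⊎ (∃ λ J → J ⊆ X ∪ ⁅ e ⁆ × t * r J < ∣ J ∣) → ∃ λ F → e ∈ F × Tight X F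
        local e e∈ (inj₁ ui′) = ⊥-elim (¬w (e , e∈ , ui′))
        local e e∈ (inj₂ (J , J⊆ , lt)) = J , tight-singleton ui J⊆ lt
      ... | F , S─X⊆F , tightF = X , id , X⊆S , ui , (begin
        s                          ≤⟨ hyp F ⟩
        t * r F + ∣ S ─ F ∣        ≤⟨ +-mono-≤ tightF (p⊆q⇒∣p∣≤∣q∣ incl) ⟩
        ∣ F ∩ X ∣ + ∣ X ─ F ∣      ≡⟨ cong (λ A → ∣ A ∣ + ∣ X ─ F ∣) (∩-comm F X) ⟩
        ∣ X ∩ F ∣ + ∣ X ─ F ∣      ≡⟨ ∣p∩q∣+∣p─q∣≡∣p∣ X F ⟩
        ∣ X ∣                      ∎)
        where
        open ≤-Reasoning
        incl : S ─ F ⊆ X ─ F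
        incl {x} x∈ with x∈p─q⁻ S F x∈ | x ∈? X
        ... | _ , x∉F | yes x∈X = x∈p∧x∉q⇒x∈p─q x∈X x∉F
        ... | x∈S , x∉F | no x∉X = ⊥-elim (x∉F (S─X⊆F (x∈p∧x∉q⇒x∈p─q x∈S x∉X)))

module _ {m : ℕ} (r : Subset m → ℕ) (isRank : IsRankFunction r) where
  open IsRankFunction isRank
  open Matroid r isRank

  -- Matroid partition

  module Partition (t : ℕ) where
    open Union t

    slice : Fin t → Subset (m * t) → Subset m
    slice i F = comprehension λ e → combine e i ∈? F

    ∈-slice⁺ : ∀ i F {e} → combine e i ∈ F → e ∈ slice i F
    ∈-slice⁺ i F = ∈-comprehension⁺ λ e → combine e i ∈? F

    ∈-slice⁻ : ∀ i F {e} → e ∈ slice i F → combine e i ∈ F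
    ∈-slice⁻ i F = ∈-comprehension⁻ λ e → combine e i ∈? F

    slice-∪ : ∀ i A B → slice i (A ∪ B) ⊆ slice i A ∪ slice i B
    slice-∪ i A B e∈ with x∈p∪q⁻ A B (∈-slice⁻ i (A ∪ B) e∈)
    ... | inj₁ a = p⊆p∪q _ (∈-slice⁺ i A a)
    ... | inj₂ b = q⊆p∪q (slice i A) _ (∈-slice⁺ i B b)

    slice-∩ : ∀ i A B → slice i (A ∩ B) ⊆ slice i A ∩ slice i B
    slice-∩ i A B e∈ with x∈p∩q⁻ A B (∈-slice⁻ i (A ∩ B) e∈)
    ... | a , b = x∈p∩q⁺ (∈-slice⁺ i A a , ∈-slice⁺ i B b)

    -- The rank function of the direct sum of `t` copies of the matroid, with `combine e i` as the
    -- `i`-th copy of `e`.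
    rᵗ : Subset (m * t) → ℕ
    rᵗ F = sumᶠ λ i → r (slice i F)

    sumᶠ-+ : ∀ {t} (f g : Fin t → ℕ) → sumᶠ f + sumᶠ g ≡ sumᶠ (λ i → f i + g i)
    sumᶠ-+ {zero}  f g = refl
    sumᶠ-+ {suc t} f g = trans (shuffle (f zero) _ _ _) (cong ((f zero + g zero) +_) (sumᶠ-+ (f ∘ suc) (g ∘ suc)))
      where
      shuffle : ∀ a b c d → (a + b) + (c + d) ≡ (a + c) + (b + d)
      shuffle = solve-∀

    rᵗ-submodular : Submodular rᵗ
    rᵗ-submodular A B = begin
      rᵗ (A ∪ B) + rᵗ (A ∩ B)                                     ≡⟨ sumᶠ-+ (λ i → r (slice i (A ∪ B))) _ ⟩
      sumᶠ (λ i → r (slice i (A ∪ B)) + r (slice i (A ∩ B)))      ≤⟨ sumᶠ-mono-≤ (λ i → ≤-trans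
                                                                       (+-mono-≤ (mono (slice-∪ i A B)) (mono (slice-∩ i A B)))
                                                                       (submodular (slice i A) (slice i B))) ⟩
      sumᶠ (λ i → r (slice i A) + r (slice i B))                  ≡⟨ sumᶠ-+ (λ i → r (slice i A)) _ ⟨
      rᵗ A + rᵗ B                                                 ∎
      where
      open ≤-Reasoning

    underlying : Fin (m * t) → Fin m
    underlying z = proj₁ (remQuot {m} t z)

    underlying-combine : ∀ e (i : Fin t) → underlying (combine e i) ≡ e
    underlying-combine e i = cong proj₁ (remQuot-combine e i)

    open Image underlying

    -- Matroid partition: Rado's theorem in the direct sum of t copies of the matroid,
    -- where the copies of one element share a colour.
    partition : ∀ X → UnionIndependent X →
      Σ (Fin t → Subset m) λ B → (∀ i → B i ⊆ X) × Disjoint B × ∣ X ∣ ≤ sumᶠ (λ i → r (B i))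
    partition X ui with rainbow-abundant underlying rᵗ rᵗ-submodular ∣ X ∣ X×t abundant
      where
      X×t : Subset (m * t)
      X×t = comprehension λ z → underlying z ∈? X
      abundant : ∀ F → ∣ X ∣ ≤ rᵗ F + ∣ image (X×t ─ F) ∣
      abundant F = begin
        ∣ X ∣                        ≡⟨ ∣p∩q∣+∣p─q∣≡∣p∣ X J ⟨
        ∣ X ∩ J ∣ + ∣ X ─ J ∣        ≤⟨ +-mono-≤ (ui (X ∩ J) (p∩q⊆p X J)) (p⊆q⇒∣p∣≤∣q∣ incl) ⟩
        t * r (X ∩ J) + ∣ image (X×t ─ F) ∣
          ≡⟨ cong (_+ ∣ image (X×t ─ F) ∣) (sumᶠ-const t _) ⟨
        sumᶠ {t} (λ _ → r (X ∩ J)) + ∣ image (X×t ─ F) ∣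
          ≤⟨ +-monoˡ-≤ _ (sumᶠ-mono-≤ λ i → mono λ x∈ → ∈-slice⁺ i F (∈-comprehension⁻ J? (p∩q⊆q X J x∈) i)) ⟩
        rᵗ F + ∣ image (X×t ─ F) ∣   ∎
        where
        open ≤-Reasoning
        -- `J` collects the elements all of whose copies lie in `F`. They are seen by every slice,
        -- which yields `t * r (X ∩ J)`; any other element of `X` has a copy outside `F` and
        -- contributes its colour.
        J? : ∀ e → Dec (∀ i → combine e i ∈ F)
        J? e = all? λ i → combine e i ∈? F
        J = comprehension J?
        incl : X ─ J ⊆ image (X×t ─ F)
        incl {e} e∈ with x∈p─q⁻ X J e∈
        ... | e∈X , e∉J with any? (λ i → ¬? (combine e i ∈? F))
        ... | no ¬w = ⊥-elim (e∉J (∈-comprehension⁺ J? λ i → decidable-stable (combine e i ∈? F) λ ∉ → ¬w (i , ∉)))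
        ... | yes (i , ei∉F) = subst (_∈ image (X×t ─ F)) (underlying-combine e i)
          (∈-image⁺ (x∈p∧x∉q⇒x∈p─q (∈-comprehension⁺ (λ z → underlying z ∈? X) (subst (_∈ X) (sym (underlying-combine e i)) e∈X)) ei∉F))
    ... | S , S⊆ , ab , rb = (λ i → slice i S) , slice⊆X , disjoint , (begin
        -- At `F = S` no colour is left outside. As the slices are disjoint subsets of `X`, this
        -- bound also makes them independent and forces them to cover `X`.
        ∣ X ∣                         ≤⟨ ab S ⟩
        rᵗ S + ∣ image (S ─ S) ∣      ≤⟨ +-monoʳ-≤ (rᵗ S) (≤-trans (∣image∣≤∣∣ (S ─ S)) (≤-reflexive (trans (cong ∣_∣ (Empty-unique empty)) (∣⊥∣≡0 (m * t))))) ⟩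
        rᵗ S + 0                      ≡⟨ +-identityʳ _ ⟩
        rᵗ S                          ∎)
      where
      open ≤-Reasoning
      empty : Empty (S ─ S)
      empty (x , x∈) with x∈p─q⁻ S S x∈
      ... | a , b = b a
      slice⊆X : ∀ i → slice i S ⊆ X
      slice⊆X i {e} e∈ = subst (_∈ X) (underlying-combine e i)
        (∈-comprehension⁻ (λ z → underlying z ∈? X) (S⊆ (∈-slice⁻ i S e∈)))
      disjoint : Disjoint λ i → slice i S
      disjoint i j e e∈i e∈j = combine-injectiveʳ e i e j (rb (combine e i) (combine e j) (∈-slice⁻ i S e∈i) (∈-slice⁻ j S e∈j)
        (trans (underlying-combine e i) (sym (underlying-combine e j))))

  -- Bases and symmetric exchange

  module Bases (q : ℕ) (rank : r ⊤ ≡ suc q) where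

    Basis : Subset m → Set
    Basis B = r B ≡ suc q × ∣ B ∣ ≡ suc q

    r≤1+q : ∀ A → r A ≤ suc q
    r≤1+q A = ≤-trans (mono {A} {⊤} ⊆⊤) (≤-reflexive rank)

    module Exchange {B₁ B₂ : Subset m} (basis₁ : Basis B₁) (basis₂ : Basis B₂) {e : Fin m} (e∈B₁ : e ∈ B₁) where

      A : Subset m
      A = B₁ - e

      ∣A∣ : ∣ A ∣ ≡ q
      ∣A∣ = suc-injective (trans (x∈p⇒1+∣p-x∣≡∣p∣ B₁ e∈B₁) (proj₂ basis₁))

      ∣B₂-g∣ : ∀ {g} → g ∈ B₂ → ∣ B₂ - g ∣ ≡ q
      ∣B₂-g∣ g∈ = suc-injective (trans (x∈p⇒1+∣p-x∣≡∣p∣ B₂ g∈) (proj₂ basis₂))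

      q≤rA : q ≤ r A
      q≤rA = ≤-pred (begin
        suc q              ≡⟨ proj₁ basis₁ ⟨
        r B₁               ≡⟨ cong r (x∈p⇒[p-x]∪⁅x⁆≡p B₁ e∈B₁) ⟨
        r (A ∪ ⁅ e ⁆)      ≤⟨ m≤m+n _ _ ⟩
        r (A ∪ ⁅ e ⁆) + r (A ∩ ⁅ e ⁆) ≤⟨ submodular A ⁅ e ⁆ ⟩
        r A + r ⁅ e ⁆      ≤⟨ +-monoʳ-≤ (r A) (≤-trans (bounded ⁅ e ⁆) (≤-reflexive (∣⁅x⁆∣≡1 e))) ⟩
        r A + 1            ≡⟨ +-comm _ 1 ⟩
        suc (r A)          ∎)
        where
        open ≤-Reasoning

      -- Elements that individually do not raise the rank of `A` do not raise it jointly: the two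
      -- sets glued in each step meet in a superset of `A`, whose rank is already `q`.
      spanned-by-A : ∀ L → (∀ g → g ∈ L → r (A ∪ ⁅ g ⁆) ≤ q) → r (A ∪ L) ≤ q
      spanned-by-A = subset-induction _
        (λ _ → ≤-trans (mono {A ∪ ⊥} {A} (∪-⊆ id (⊆-min A))) (≤-trans (bounded A) (≤-reflexive ∣A∣)))
        λ D g _ ih h → +-cancelʳ-≤ (r A) _ _ (begin
          r (A ∪ (D ∪ ⁅ g ⁆)) + r A
            ≤⟨ +-mono-≤ (mono {A ∪ (D ∪ ⁅ g ⁆)} {(A ∪ D) ∪ (A ∪ ⁅ g ⁆)}
                          (∪-⊆ (λ x∈ → p⊆p∪q _ (p⊆p∪q D x∈))
                               (∪-⊆ (λ x∈ → p⊆p∪q _ (q⊆p∪q A D x∈)) (λ x∈ → q⊆p∪q (A ∪ D) _ (q⊆p∪q A _ x∈)))))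
                        (mono {A} {(A ∪ D) ∩ (A ∪ ⁅ g ⁆)} (λ x∈ → x∈p∩q⁺ (p⊆p∪q D x∈ , p⊆p∪q _ x∈))) ⟩
          r ((A ∪ D) ∪ (A ∪ ⁅ g ⁆)) + r ((A ∪ D) ∩ (A ∪ ⁅ g ⁆)) ≤⟨ submodular (A ∪ D) (A ∪ ⁅ g ⁆) ⟩
          r (A ∪ D) + r (A ∪ ⁅ g ⁆)   ≤⟨ +-mono-≤ (ih λ d d∈ → h d (p⊆p∪q _ d∈)) (h g (q⊆p∪q D _ (x∈⁅x⁆ g))) ⟩
          q + q                       ≤⟨ +-monoʳ-≤ q q≤rA ⟩
          q + r A                     ∎)
        where
        open ≤-Reasoning

      -- If `e` is spanned by `B₂ - g` for each `g` in `K`, it is spanned after deleting all of `K`.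
      -- In each step the two sets to be intersected both contain `e`, and their union contains
      -- `B₂`, so it has full rank; submodularity then pushes the loss of rank into the
      -- intersection.
      spans-e : ∀ K → K ⊆ B₂ → (∀ g → g ∈ K → r ((B₂ - g) ∪ ⁅ e ⁆) ≤ q) → r ((B₂ ─ K) ∪ ⁅ e ⁆) ≤ ∣ B₂ ─ K ∣
      spans-e = subset-induction _
        (λ _ _ → ≤-trans (r≤1+q _) (≤-reflexive (trans (sym (proj₂ basis₂)) (cong ∣_∣ (sym (p─⊥≡p B₂))))))
        insertion
        where
        open ≤-Reasoning
        insertion : ∀ D g → g ∉ D → (D ⊆ B₂ → (∀ g → g ∈ D → r ((B₂ - g) ∪ ⁅ e ⁆) ≤ q) → r ((B₂ ─ D) ∪ ⁅ e ⁆) ≤ ∣ B₂ ─ D ∣) →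
          (D ∪ ⁅ g ⁆) ⊆ B₂ → (∀ h → h ∈ D ∪ ⁅ g ⁆ → r ((B₂ - h) ∪ ⁅ e ⁆) ≤ q) →
          r ((B₂ ─ (D ∪ ⁅ g ⁆)) ∪ ⁅ e ⁆) ≤ ∣ B₂ ─ (D ∪ ⁅ g ⁆) ∣
        insertion D g g∉D ih ⊆B₂ hyp = +-cancelʳ-≤ (suc q) _ _ (begin
          r (R ∪ ⁅ e ⁆) + suc q     ≡⟨ +-comm _ (suc q) ⟩
          suc q + r (R ∪ ⁅ e ⁆)     ≤⟨ +-mono-≤ (≤-trans (≤-reflexive (sym (proj₁ basis₂))) (mono B₂⊆)) (mono R⊆) ⟩
          r ((P ∪ ⁅ e ⁆) ∪ (Q ∪ ⁅ e ⁆)) + r ((P ∪ ⁅ e ⁆) ∩ (Q ∪ ⁅ e ⁆)) ≤⟨ submodular (P ∪ ⁅ e ⁆) (Q ∪ ⁅ e ⁆) ⟩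
          r (P ∪ ⁅ e ⁆) + r (Q ∪ ⁅ e ⁆)   ≤⟨ +-mono-≤ (ih (λ x∈ → ⊆B₂ (p⊆p∪q _ x∈)) (λ d d∈ → hyp d (p⊆p∪q _ d∈)))
                                               (hyp g (q⊆p∪q D _ (x∈⁅x⁆ g))) ⟩
          ∣ P ∣ + q                 ≡⟨ cong (_+ q) (x∈p⇒1+∣p-x∣≡∣p∣ P g∈P) ⟨
          suc ∣ P - g ∣ + q         ≡⟨ +-suc _ q ⟨
          ∣ P - g ∣ + suc q         ≡⟨ cong (λ Z → ∣ Z ∣ + suc q) (p─q─r≡p─q∪r B₂ D ⁅ g ⁆) ⟩
          ∣ R ∣ + suc q             ∎)
          where
          P = B₂ ─ D
          Q = B₂ - g
          R = B₂ ─ (D ∪ ⁅ g ⁆)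
          g∈P : g ∈ P
          g∈P = x∈p∧x∉q⇒x∈p─q (⊆B₂ (q⊆p∪q D _ (x∈⁅x⁆ g))) g∉D
          B₂⊆ : B₂ ⊆ (P ∪ ⁅ e ⁆) ∪ (Q ∪ ⁅ e ⁆)
          B₂⊆ {x} x∈ with x Finₚ.≟ g
          ... | yes refl = p⊆p∪q _ (p⊆p∪q _ g∈P)
          ... | no x≢g = q⊆p∪q (P ∪ ⁅ e ⁆) _ (p⊆p∪q _ (x∈p∧x≢y⇒x∈p-y x∈ x≢g))
          R⊆ : R ∪ ⁅ e ⁆ ⊆ (P ∪ ⁅ e ⁆) ∩ (Q ∪ ⁅ e ⁆)
          R⊆ x∈ with x∈p∪q⁻ R ⁅ e ⁆ x∈
          ... | inj₂ x∈e = x∈p∩q⁺ (q⊆p∪q P _ x∈e , q⊆p∪q Q _ x∈e)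
          ... | inj₁ x∈R with x∈p─q⁻ B₂ (D ∪ ⁅ g ⁆) x∈R
          ... | x∈B , x∉ = x∈p∩q⁺ (p⊆p∪q _ (x∈p∧x∉q⇒x∈p─q x∈B (x∉ ∘ p⊆p∪q _)) , p⊆p∪q _ (x∈p∧x∉q⇒x∈p─q x∈B (x∉ ∘ q⊆p∪q D _)))

      sub-B₂-independent : ∀ L → L ⊆ B₂ → ∣ L ∣ ≤ r L
      sub-B₂-independent L L⊆ = +-cancelʳ-≤ (∣ B₂ ─ L ∣) _ _ (begin
        ∣ L ∣ + ∣ B₂ ─ L ∣          ≤⟨ +-monoˡ-≤ _ (p⊆q⇒∣p∣≤∣q∣ λ x∈ → x∈p∩q⁺ (L⊆ x∈ , x∈)) ⟩
        ∣ B₂ ∩ L ∣ + ∣ B₂ ─ L ∣     ≡⟨ ∣p∩q∣+∣p─q∣≡∣p∣ B₂ L ⟩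
        ∣ B₂ ∣                      ≡⟨ trans (proj₂ basis₂) (sym (proj₁ basis₂)) ⟩
        r B₂                        ≤⟨ mono B₂⊆ ⟩
        r (L ∪ (B₂ ─ L))            ≤⟨ m≤m+n _ _ ⟩
        r (L ∪ (B₂ ─ L)) + r (L ∩ (B₂ ─ L)) ≤⟨ submodular L (B₂ ─ L) ⟩
        r L + r (B₂ ─ L)            ≤⟨ +-monoʳ-≤ (r L) (bounded (B₂ ─ L)) ⟩
        r L + ∣ B₂ ─ L ∣            ∎)
        where
        open ≤-Reasoning
        B₂⊆ : B₂ ⊆ L ∪ (B₂ ─ L)
        B₂⊆ {x} x∈ with x ∈? L
        ... | yes x∈L = p⊆p∪q _ x∈L
        ... | no x∉L = q⊆p∪q L _ (x∈p∧x∉q⇒x∈p─q x∈ x∉L)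

      -- Let `K` consist of the `g` in `B₂` that complete `A` to full rank. If all of them fail on
      -- the other side, `e` is spanned by the remainder `L`, while `L` is spanned by `A`. Then `A`
      -- spans `e`, although `A` together with `e` is the basis `B₁`; the chain below is this
      -- transitivity as one submodular inequality.
      symmetric-exchange : ∃ λ g → g ∈ B₂ × Basis (A ∪ ⁅ g ⁆) × Basis ((B₂ - g) ∪ ⁅ e ⁆)
      symmetric-exchange with any? (λ g → (g ∈? B₂) ×-dec (suc q ≤? r (A ∪ ⁅ g ⁆)) ×-dec (suc q ≤? r ((B₂ - g) ∪ ⁅ e ⁆)))
      ... | yes (g , g∈ , r₁ , r₂) = g , g∈ , mkBasis ∣A∣ r₁ , mkBasis (∣B₂-g∣ g∈) r₂
        where
        mkBasis : ∀ {S x} → ∣ S ∣ ≡ q → suc q ≤ r (S ∪ ⁅ x ⁆) → Basis (S ∪ ⁅ x ⁆)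
        mkBasis {S} {x} ∣S∣ r≥ = ≤-antisym (r≤1+q _) r≥ , ≤-antisym
          (≤-trans (∣p∪q∣≤∣p∣+∣q∣ S ⁅ x ⁆) (≤-reflexive (trans (cong₂ _+_ ∣S∣ (∣⁅x⁆∣≡1 x)) (+-comm q 1))))
          (≤-trans r≥ (bounded _))
      ... | no ¬w = ⊥-elim (1+n≰n (+-cancelʳ-≤ (∣ L ∣) _ _ (begin
          suc q + ∣ L ∣                        ≤⟨ +-mono-≤ (≤-trans (≤-reflexive (sym (proj₁ basis₁))) (mono B₁⊆))
                                                           (≤-trans (sub-B₂-independent L (p─q⊆p B₂ K)) (mono L⊆)) ⟩
          r ((A ∪ L) ∪ (L ∪ ⁅ e ⁆)) + r ((A ∪ L) ∩ (L ∪ ⁅ e ⁆)) ≤⟨ submodular (A ∪ L) (L ∪ ⁅ e ⁆) ⟩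
          r (A ∪ L) + r (L ∪ ⁅ e ⁆)            ≤⟨ +-mono-≤ (spanned-by-A L L-spanned) (spans-e K K⊆B₂ K-spans) ⟩
          q + ∣ L ∣                            ∎)))
        where
        open ≤-Reasoning
        K? : ∀ g → Dec (g ∈ B₂ × suc q ≤ r (A ∪ ⁅ g ⁆))
        K? g = (g ∈? B₂) ×-dec (suc q ≤? r (A ∪ ⁅ g ⁆))
        K = comprehension K?
        L = B₂ ─ K
        K⊆B₂ : K ⊆ B₂
        K⊆B₂ g∈ = proj₁ (∈-comprehension⁻ K? g∈)
        K-spans : ∀ g → g ∈ K → r ((B₂ - g) ∪ ⁅ e ⁆) ≤ q
        K-spans g g∈ with ∈-comprehension⁻ K? g∈
        ... | g∈B , r≥ = ≤-pred (≰⇒> λ r≥′ → ¬w (g , g∈B , r≥ , r≥′))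
        L-spanned : ∀ g → g ∈ L → r (A ∪ ⁅ g ⁆) ≤ q
        L-spanned g g∈ with x∈p─q⁻ B₂ K g∈
        ... | g∈B , g∉K = ≤-pred (≰⇒> λ r≥ → g∉K (∈-comprehension⁺ K? (g∈B , r≥)))
        B₁⊆ : B₁ ⊆ (A ∪ L) ∪ (L ∪ ⁅ e ⁆)
        B₁⊆ {x} x∈ with x Finₚ.≟ e
        ... | yes refl = q⊆p∪q (A ∪ L) _ (q⊆p∪q L _ (x∈⁅x⁆ e))
        ... | no x≢e = p⊆p∪q _ (p⊆p∪q L (x∈p∧x≢y⇒x∈p-y x∈ x≢e))
        L⊆ : L ⊆ (A ∪ L) ∩ (L ∪ ⁅ e ⁆)
        L⊆ x∈ = x∈p∩q⁺ (q⊆p∪q A L x∈ , p⊆p∪q _ x∈)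

-- Packing rainbow bases

module RainbowBases {m p : ℕ} (r : Subset m → ℕ) (isRank : IsRankFunction r) (q : ℕ) (rank : r ⊤ ≡ suc q)
  (c : Fin m → Fin p) (t : ℕ) where
  open IsRankFunction isRank
  open Matroid r isRank
  open Union t
  open Partition r isRank t using (partition)
  open Bases r isRank q rank
  open Image c

  ∣image∣-basis≤ : ∀ {B} → Basis B → ∣ image B ∣ ≤ suc q
  ∣image∣-basis≤ {B} b = ≤-trans (∣image∣≤∣∣ B) (≤-reflexive (proj₂ b))

  repeated-colour : ∀ {B e f} → Basis B → e ∈ B → f ∈ B → c e ≡ c f → e ≢ f → ∣ image B ∣ ≤ q
  repeated-colour {B} {e} {f} b e∈ f∈ ce≡cf e≢f = ≤-trans (p⊆q⇒∣p∣≤∣q∣ incl)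
    (≤-trans (∣image∣≤∣∣ (B - e)) (≤-reflexive (suc-injective (trans (x∈p⇒1+∣p-x∣≡∣p∣ B e∈) (proj₂ b)))))
    where
    incl : image B ⊆ image (B - e)
    incl x∈ with ∈-image⁻ x∈
    ... | d , d∈ , refl with d Finₚ.≟ e
    ... | yes refl = subst (_∈ image (B - e)) (sym ce≡cf) (∈-image⁺ (x∈p∧x≢y⇒x∈p-y f∈ (e≢f ∘ sym)))
    ... | no d≢e = ∈-image⁺ (x∈p∧x≢y⇒x∈p-y d∈ d≢e)

  -- If every basis shared a colour with a non-rainbow B i, each basis would add at most q colours.
  colour-disjoint-basis : ∀ X (B : Fin t → Subset m) → (∀ l → Basis (B l)) → (∀ {x} → x ∈ X → ∃ λ l → x ∈ B l) →
    t * q < ∣ image X ∣ → ∀ i → ∣ image (B i) ∣ ≤ q → ∃ λ j → ∀ {x} → x ∈ image (B j) → x ∉ image (B i)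
  colour-disjoint-basis X B bases cover many i few with any? (λ j → ¬? (nonempty? (image (B j) ∩ image (B i))))
  ... | yes (j , ¬ne) = j , λ x∈j x∈i → ¬ne (_ , x∈p∩q⁺ (x∈j , x∈i))
  ... | no ¬w = ⊥-elim (<⇒≱ many (begin
      ∣ image X ∣                ≤⟨ ∣∣≤sumᶠ-cover (image X) D D-cover ⟩
      sumᶠ (λ l → ∣ D l ∣)       ≤⟨ sumᶠ-mono-≤ D-small ⟩
      sumᶠ {t} (λ _ → q)         ≡⟨ sumᶠ-const t q ⟩
      t * q                      ∎))
    where
    open ≤-Reasoning
    shared : ∀ j → Nonempty (image (B j) ∩ image (B i))
    shared j = decidable-stable (nonempty? _) λ ¬ne → ¬w (j , ¬ne)
    -- The discarded colour is shared with `B i`, hence still covered by `D i`.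
    D : Fin t → Subset p
    D l with l Finₚ.≟ i
    ... | yes _ = image (B i)
    ... | no  _ = image (B l) - proj₁ (shared l)
    D-small : ∀ l → ∣ D l ∣ ≤ q
    D-small l with l Finₚ.≟ i
    ... | yes _ = few
    ... | no  _ with shared l
    ... | x , x∈ = ≤-pred (<-≤-trans (x∈p⇒∣p-x∣<∣p∣ (p∩q⊆p _ _ x∈)) (∣image∣-basis≤ (bases l)))
    D-i : ∀ {x} → x ∈ image (B i) → x ∈ D i
    D-i x∈ with i Finₚ.≟ i
    ... | yes _ = x∈
    ... | no i≢i = ⊥-elim (i≢i refl)
    D-cover : ∀ {x} → x ∈ image X → ∃ λ l → x ∈ D l
    D-cover {x} x∈ with x ∈? image (B i)
    ... | yes x∈i = i , D-i x∈i
    ... | no x∉i with ∈-image⁻ x∈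
    ... | d , d∈X , refl with cover d∈X
    ... | l , d∈ = l , D-l
      where
      D-l : c d ∈ D l
      D-l with l Finₚ.≟ i
      ... | yes refl = ⊥-elim (x∉i (∈-image⁺ d∈))
      ... | no _ = x∈p∧x≢y⇒x∈p-y (∈-image⁺ d∈) λ eq → x∉i (subst (_∈ image (B i)) (sym eq) (p∩q⊆q (image (B l)) _ (proj₂ (shared l))))

  module Swap (B : Fin t → Subset m) (disjoint : Disjoint B) {i j : Fin t} (i≢j : i ≢ j) {e g : Fin m} (e∈ : e ∈ B i) (g∈ : g ∈ B j) where

    swap : Fin t → Subset m
    swap l with l Finₚ.≟ i | l Finₚ.≟ j
    ... | yes _ | _     = (B i - e) ∪ ⁅ g ⁆
    ... | no _  | yes _ = (B j - g) ∪ ⁅ e ⁆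
    ... | no _  | no _  = B l

    swap-elim : (P : Fin t → Subset m → Set) → P i ((B i - e) ∪ ⁅ g ⁆) → P j ((B j - g) ∪ ⁅ e ⁆) → (∀ l → l ≢ i → l ≢ j → P l (B l)) →
      ∀ l → P l (swap l)
    swap-elim P Pi Pj Pl l with l Finₚ.≟ i | l Finₚ.≟ j
    ... | yes refl | _     = Pi
    ... | no _  | yes refl = Pj
    ... | no l≢i  | no l≢j  = Pl l l≢i l≢j

    swap-i : swap i ≡ (B i - e) ∪ ⁅ g ⁆
    swap-i with i Finₚ.≟ i
    ... | yes _ = refl
    ... | no i≢i = ⊥-elim (i≢i refl)

    swap-j : swap j ≡ (B j - g) ∪ ⁅ e ⁆
    swap-j with j Finₚ.≟ i | j Finₚ.≟ j
    ... | yes j≡i | _ = ⊥-elim (i≢j (sym j≡i))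
    ... | no _ | yes _ = refl
    ... | no _ | no j≢j = ⊥-elim (j≢j refl)

    -- The `old` case excludes both exchanged elements, so that disjointness after the swap follows
    -- by comparing the origins of an element in two members.
    data Origin (x : Fin m) (l : Fin t) : Set where
      new-g : x ≡ g → l ≡ i → Origin x l
      new-e : x ≡ e → l ≡ j → Origin x l
      old   : x ≢ g → x ≢ e → x ∈ B l → Origin x l

    origin : ∀ l {x} → x ∈ swap l → Origin x l
    origin = swap-elim (λ l S → ∀ {x} → x ∈ S → Origin x l) at-i at-j at-l
      where
      at-i : ∀ {x} → x ∈ (B i - e) ∪ ⁅ g ⁆ → Origin x i
      at-i x∈ with x∈p∪q⁻ (B i - e) ⁅ g ⁆ x∈
      ... | inj₂ x∈g = new-g (x∈⁅y⁆⇒x≡y g x∈g) refl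
      ... | inj₁ x∈B with x∈p-y⁻ (B i) x∈B
      ... | x∈Bi , x≢e = old (λ { refl → i≢j (disjoint i j _ x∈Bi g∈) }) x≢e x∈Bi
      at-j : ∀ {x} → x ∈ (B j - g) ∪ ⁅ e ⁆ → Origin x j
      at-j x∈ with x∈p∪q⁻ (B j - g) ⁅ e ⁆ x∈
      ... | inj₂ x∈e = new-e (x∈⁅y⁆⇒x≡y e x∈e) refl
      ... | inj₁ x∈B with x∈p-y⁻ (B j) x∈B
      ... | x∈Bj , x≢g = old x≢g (λ { refl → i≢j (disjoint i j _ e∈ x∈Bj) }) x∈Bj
      at-l : ∀ l → l ≢ i → l ≢ j → ∀ {x} → x ∈ B l → Origin x l
      at-l l l≢i l≢j x∈ = old (λ { refl → l≢j (disjoint l j _ x∈ g∈) }) (λ { refl → l≢i (disjoint l i _ x∈ e∈) }) x∈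

    e≢g : e ≢ g
    e≢g refl = i≢j (disjoint i j _ e∈ g∈)

    swap-disjoint : Disjoint swap
    swap-disjoint l k x x∈l x∈k with origin l x∈l | origin k x∈k
    ... | new-g _ l≡i | new-g _ k≡i = trans l≡i (sym k≡i)
    ... | new-e _ l≡j | new-e _ k≡j = trans l≡j (sym k≡j)
    ... | new-g x≡g _ | new-e x≡e _ = ⊥-elim (e≢g (trans (sym x≡e) x≡g))
    ... | new-e x≡e _ | new-g x≡g _ = ⊥-elim (e≢g (trans (sym x≡e) x≡g))
    ... | new-g x≡g _ | old x≢g _ _ = ⊥-elim (x≢g x≡g)
    ... | old x≢g _ _ | new-g x≡g _ = ⊥-elim (x≢g x≡g)
    ... | new-e x≡e _ | old _ x≢e _ = ⊥-elim (x≢e x≡e)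
    ... | old _ x≢e _ | new-e x≡e _ = ⊥-elim (x≢e x≡e)
    ... | old _ _ a   | old _ _ b   = disjoint l k x a b

    swap-cover : ∀ {x} → (∃ λ l → x ∈ B l) → ∃ λ l → x ∈ swap l
    swap-cover {x} (l , x∈) with x Finₚ.≟ g | x Finₚ.≟ e
    ... | yes refl | _ = i , subst (g ∈_) (sym swap-i) (q⊆p∪q (B i - e) _ (x∈⁅x⁆ g))
    ... | no _ | yes refl = j , subst (e ∈_) (sym swap-j) (q⊆p∪q (B j - g) _ (x∈⁅x⁆ e))
    ... | no x≢g | no x≢e = l , swap-elim (λ l S → x ∈ B l → x ∈ S)
      (λ x∈i → p⊆p∪q _ (x∈p∧x≢y⇒x∈p-y x∈i x≢e)) (λ x∈j → p⊆p∪q _ (x∈p∧x≢y⇒x∈p-y x∈j x≢g)) (λ _ _ _ x∈l → x∈l) l x∈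

    swap-bases : (∀ l → Basis (B l)) → Basis ((B i - e) ∪ ⁅ g ⁆) → Basis ((B j - g) ∪ ⁅ e ⁆) → ∀ l → Basis (swap l)
    swap-bases bases bi bj = swap-elim (λ _ → Basis) bi bj λ l _ _ → bases l

    -- Exchanging a repeated colour of B i against an element of a basis without common colours gains a colour.
    swap-gains : ∀ {f} → f ∈ B i → c e ≡ c f → e ≢ f → (∀ {x} → x ∈ image (B j) → x ∉ image (B i)) →
      sumᶠ (λ l → ∣ image (B l) ∣) < sumᶠ (λ l → ∣ image (swap l) ∣)
    swap-gains {f} f∈ ce≡cf e≢f apart = sumᶠ-mono-< (swap-elim (λ l S → ∣ image (B l) ∣ ≤ ∣ image S ∣) (<⇒≤ gain-i) keep-j λ _ _ _ → ≤-refl) i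
        (subst (λ S → ∣ image (B i) ∣ < ∣ image S ∣) (sym swap-i) gain-i)
      where
      open ≤-Reasoning
      -- The colour of `e` remains through `f`, and the colour of `g` is new to `B i`.
      gain-i : ∣ image (B i) ∣ < ∣ image ((B i - e) ∪ ⁅ g ⁆) ∣
      gain-i = begin
        suc ∣ image (B i) ∣               ≡⟨ x∉p⇒∣p∪⁅x⁆∣≡1+∣p∣ (image (B i)) (apart (∈-image⁺ g∈)) ⟨
        ∣ image (B i) ∪ ⁅ c g ⁆ ∣         ≤⟨ p⊆q⇒∣p∣≤∣q∣ (∪-⊆ incl (x∈p⇒⁅x⁆⊆p (∈-image⁺ (q⊆p∪q (B i - e) _ (x∈⁅x⁆ g))))) ⟩
        ∣ image ((B i - e) ∪ ⁅ g ⁆) ∣     ∎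
        where
        incl : image (B i) ⊆ image ((B i - e) ∪ ⁅ g ⁆)
        incl x∈ with ∈-image⁻ x∈
        ... | d , d∈ , refl with d Finₚ.≟ e
        ... | yes refl = subst (_∈ image ((B i - e) ∪ ⁅ g ⁆)) (sym ce≡cf) (∈-image⁺ (p⊆p∪q _ (x∈p∧x≢y⇒x∈p-y f∈ (e≢f ∘ sym))))
        ... | no d≢e = ∈-image⁺ (p⊆p∪q _ (x∈p∧x≢y⇒x∈p-y d∈ d≢e))
      -- Dropping `g` costs at most its colour, and `e` brings in a colour that `B j` did not have.
      keep-j : ∣ image (B j) ∣ ≤ ∣ image ((B j - g) ∪ ⁅ e ⁆) ∣
      keep-j = begin
        ∣ image (B j) ∣                          ≤⟨ p⊆q⇒∣p∣≤∣q∣ incl ⟩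
        ∣ image (B j - g) ∪ ⁅ c g ⁆ ∣            ≤⟨ ∣p∪q∣≤∣p∣+∣q∣ (image (B j - g)) ⁅ c g ⁆ ⟩
        ∣ image (B j - g) ∣ + ∣ ⁅ c g ⁆ ∣        ≡⟨ trans (cong (∣ image (B j - g) ∣ +_) (∣⁅x⁆∣≡1 (c g))) (+-comm _ 1) ⟩
        suc ∣ image (B j - g) ∣                  ≡⟨ x∉p⇒∣p∪⁅x⁆∣≡1+∣p∣ (image (B j - g)) (λ ce∈ → apart (image-mono (p─q⊆p (B j) ⁅ g ⁆) ce∈) (∈-image⁺ e∈)) ⟨
        ∣ image (B j - g) ∪ ⁅ c e ⁆ ∣            ≤⟨ p⊆q⇒∣p∣≤∣q∣ (∪-⊆ (image-mono (p⊆p∪q _)) (x∈p⇒⁅x⁆⊆p (∈-image⁺ (q⊆p∪q (B j - g) _ (x∈⁅x⁆ e))))) ⟩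
        ∣ image ((B j - g) ∪ ⁅ e ⁆) ∣            ∎
        where
        incl : image (B j) ⊆ image (B j - g) ∪ ⁅ c g ⁆
        incl x∈ with ∈-image⁻ x∈
        ... | d , d∈ , refl with d Finₚ.≟ g
        ... | yes refl = q⊆p∪q (image (B j - g)) _ (x∈⁅x⁆ (c g))
        ... | no d≢g = p⊆p∪q _ (∈-image⁺ (x∈p∧x≢y⇒x∈p-y d∈ d≢g))

  RainbowPacking : Set
  RainbowPacking = Σ (Fin t → Subset m) λ B → (∀ l → Basis (B l) × RainbowOn (B l)) × Disjoint B

  -- The counter `k` bounds how far the sum of the colour numbers lies below `t * suc q`, the value
  -- at which all bases are rainbow. A swap raises the sum and still covers `X`, so the bound on
  -- `image X` keeps supplying a colour-disjoint partner.
  make-rainbow : ∀ X (B : Fin t → Subset m) → (∀ l → Basis (B l)) → Disjoint B → (∀ {x} → x ∈ X → ∃ λ l → x ∈ B l) →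
    t * q < ∣ image X ∣ → RainbowPacking
  make-rainbow X B bases disjoint cover many = go (t * suc q) B (m≤m+n _ _) bases disjoint cover
    where
    go : ∀ k (B : Fin t → Subset m) → t * suc q ≤ k + sumᶠ (λ l → ∣ image (B l) ∣) →
      (∀ l → Basis (B l)) → Disjoint B → (∀ {x} → x ∈ X → ∃ λ l → x ∈ B l) → RainbowPacking
    go k B enough bases disjoint cover with any? (λ l → ¬? (∣ image (B l) ∣ Data.Nat.≟ suc q))
    go k B enough bases disjoint cover | no ¬w = B , (λ l → bases l , rainbow l) , disjoint
      where
      rainbow : ∀ l → RainbowOn (B l)
      rainbow l with rainbow? (B l)
      ... | inj₁ rb = rb
      ... | inj₂ (e , f , e∈ , f∈ , ce≡cf , e≢f) =
        ⊥-elim (¬w (l , λ eq → 1+n≰n (≤-trans (≤-reflexive (sym eq)) (repeated-colour (bases l) e∈ f∈ ce≡cf e≢f))))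
    go zero B enough bases disjoint cover | yes (i , ≢q) =
      ⊥-elim (≢q (sumᶠ-saturated (suc q) (λ l → ∣image∣-basis≤ (bases l)) enough i))
    go (suc k) B enough bases disjoint cover | yes (i , ≢q) with rainbow? (B i)
    ... | inj₁ rb = ⊥-elim (≢q (≤-antisym (∣image∣-basis≤ (bases i))
            (≤-trans (≤-reflexive (sym (proj₂ (bases i)))) (rainbow⇒∣∣≤∣image∣ (B i) rb))))
    ... | inj₂ (e , f , e∈ , f∈ , ce≡cf , e≢f)
      with colour-disjoint-basis X B bases cover many i (repeated-colour (bases i) e∈ f∈ ce≡cf e≢f)
    ... | j , apart with Exchange.symmetric-exchange (bases i) (bases j) e∈
    ... | g , g∈ , bi , bj = go k swap enough′ (swap-bases bases bi bj) swap-disjoint (swap-cover ∘ cover)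
      where
      i≢j : i ≢ j
      i≢j refl = apart (∈-image⁺ e∈) (∈-image⁺ e∈)
      open Swap B disjoint i≢j e∈ g∈
      enough′ : t * suc q ≤ k + sumᶠ (λ l → ∣ image (swap l) ∣)
      enough′ = ≤-trans enough (≤-trans (≤-reflexive (sym (+-suc k _))) (+-monoʳ-≤ k (swap-gains f∈ ce≡cf e≢f apart)))

  -- The hypotheses are Rado's condition for a rainbow union-independent `I` with more than `t * q`
  -- elements and Edmonds' condition for extending `I` to a union `X` of `t` bases. What is kept of
  -- the rainbow property is `∣ I ∣ ≤ ∣ image X ∣`.
  rainbow-packing : (∀ F → suc (t * q) ≤ t * r F + ∣ image (⊤ ─ F) ∣) → (∀ F → t * suc q ≤ t * r F + ∣ ⊤ ─ F ∣) → RainbowPacking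
  rainbow-packing many-colours many-elements
    with rainbow-abundant c (λ F → t * r F) t*r-submodular (suc (t * q)) ⊤ many-colours
    where
    t*r-submodular : Submodular λ F → t * r F
    t*r-submodular A B = ≤-trans (≤-reflexive (sym (*-distribˡ-+ t _ _)))
      (≤-trans (*-monoʳ-≤ t (submodular A B)) (≤-reflexive (*-distribˡ-+ t _ _)))
  ... | S , _ , abundant , rb
    with extend S (suc (t * q)) (λ F → ≤-trans (abundant F) (+-monoʳ-≤ (t * r F) (∣image∣≤∣∣ (S ─ F)))) ⊥ ⊥⊆
           (λ J J⊆ → ≤-trans (≤-trans (p⊆q⇒∣p∣≤∣q∣ J⊆) (≤-reflexive (∣⊥∣≡0 m))) z≤n)
  ... | I , _ , I⊆S , ui-I , big-I with extend ⊤ (t * suc q) many-elements I ⊆⊤ ui-I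
  ... | X , I⊆X , _ , ui-X , big-X with partition X ui-X
  ... | B , B⊆X , disjoint , X≤ = make-rainbow X B (λ l → rank-B l , card-B l) disjoint cover
    (≤-trans (≤-trans big-I (rainbow⇒∣∣≤∣image∣ I λ e f e∈ f∈ → rb e f (I⊆S e∈) (I⊆S f∈))) (p⊆q⇒∣p∣≤∣q∣ (image-mono I⊆X)))
    where
    -- This and the next facts are the equality cases in `t * suc q ≤ ∣ X ∣ ≤ sumᶠ (r ∘ B)` and in
    -- `sumᶠ (∣_∣ ∘ B) ≤ ∣ X ∣ ≤ t * suc q`.
    rank-B : ∀ l → r (B l) ≡ suc q
    rank-B = sumᶠ-saturated (suc q) (λ l → r≤1+q (B l)) (≤-trans big-X X≤)
    X≤tρ : ∣ X ∣ ≤ t * suc q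
    X≤tρ = ≤-trans (ui-X X id) (*-monoʳ-≤ t (r≤1+q X))
    B≥ : ∀ l → suc q ≤ ∣ B l ∣
    B≥ l = ≤-trans (≤-reflexive (sym (rank-B l))) (bounded (B l))
    card-B : ∀ l → ∣ B l ∣ ≡ suc q
    card-B l with m≤n⇒m<n∨m≡n (B≥ l)
    ... | inj₂ eq = sym eq
    ... | inj₁ lt = ⊥-elim (<⇒≱ (<-≤-trans (≤-<-trans (≤-reflexive (sym (sumᶠ-const t (suc q)))) (sumᶠ-mono-< B≥ l lt)) (sumᶠ-disjoint≤∣∣ X B B⊆X disjoint)) X≤tρ)
    cover : ∀ {x} → x ∈ X → ∃ λ l → x ∈ B l
    cover {x} x∈ with any? (λ l → x ∈? B l)
    ... | yes w = w
    ... | no ¬w = ⊥-elim (<⇒≱ (≤-<-trans (≤-trans (≤-trans X≤tρ (≤-trans (≤-reflexive (sym (sumᶠ-const t (suc q)))) (sumᶠ-mono-≤ B≥)))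
        (sumᶠ-disjoint≤∣∣ (X - x) B (λ l y∈ → x∈p∧x≢y⇒x∈p-y (B⊆X l y∈) λ { refl → ¬w (l , y∈) }) disjoint)) (x∈p⇒∣p-x∣<∣p∣ x∈)) ≤-refl)

-- Signed graphs

module SignedWalks (G : SGraph) where
  open SGraph G renaming (n to order; m to size)

  private variable
    F F′ : Subset size
    s s′ : Bool
    u v w : Fin order
    e : Fin size

  joins-sym : Joins G e u v → Joins G e v u
  joins-sym (inj₁ eq) = inj₂ eq
  joins-sym (inj₂ eq) = inj₁ eq

  joins-unique : ∀ {x y} → Joins G e x y → Joins G e u v → (u ≡ x × v ≡ y) ⊎ (u ≡ y × v ≡ x)
  joins-unique (inj₁ p) (inj₁ q) with refl ← trans (sym p) q = inj₁ (refl , refl)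
  joins-unique (inj₁ p) (inj₂ q) with refl ← trans (sym p) q = inj₂ (refl , refl)
  joins-unique (inj₂ p) (inj₁ q) with refl ← trans (sym p) q = inj₂ (refl , refl)
  joins-unique (inj₂ p) (inj₂ q) with refl ← trans (sym p) q = inj₁ (refl , refl)

  -- Walk F s u v: a walk from u to v in F whose sign is − iff s ≡ true.
  data Walk (F : Subset size) : Bool → Fin order → Fin order → Set where
    nil  : Walk F false u u
    cons : (e : Fin size) → e ∈ F → Joins G e u w → Walk F s w v → Walk F (neg e xor s) u v

  walk-trans : Walk F s u v → Walk F s′ v w → Walk F (s xor s′) u w
  walk-trans nil q = q
  walk-trans {F = F} {s′ = s′} (cons {s = s} e e∈ j p) q =
    subst (λ b → Walk F b _ _) (sym (xor-assoc (neg e) s s′)) (cons e e∈ j (walk-trans p q))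

  walk-edge : e ∈ F → Joins G e u v → Walk F (neg e) u v
  walk-edge {e = e} {F = F} e∈ j = subst (λ b → Walk F b _ _) (Boolₚ.xor-identityʳ (neg e)) (cons e e∈ j nil)

  walk-sym : Walk F s u v → Walk F s v u
  walk-sym nil = nil
  walk-sym {F = F} (cons {s = s} e e∈ j p) =
    subst (λ b → Walk F b _ _) (xor-comm s (neg e)) (walk-trans (walk-sym p) (walk-edge e∈ (joins-sym j)))

  walk-mono : F ⊆ F′ → Walk F s u v → Walk F′ s u v
  walk-mono F⊆ nil = nil
  walk-mono F⊆ (cons e e∈ j p) = cons e (F⊆ e∈) j (walk-mono F⊆ p)

  walk⇒conn : Walk F s u v → Conn G F u v
  walk⇒conn nil = here
  walk⇒conn (cons e e∈ j p) = step e e∈ j (walk⇒conn p)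

  conn⇒walk : Conn G F u v → ∃ λ s → Walk F s u v
  conn⇒walk here = false , nil
  conn⇒walk (step e e∈ j p) with conn⇒walk p
  ... | s , q = neg e xor s , cons e e∈ j q

  conn-trans : Conn G F u v → Conn G F v w → Conn G F u w
  conn-trans here q = q
  conn-trans (step e e∈ j p) q = step e e∈ j (conn-trans p q)

  conn-sym : Conn G F u v → Conn G F v u
  conn-sym p = walk⇒conn (walk-sym (proj₂ (conn⇒walk p)))

  -- A negative closed walk instead of a negative cycle: walks can be composed, reversed and moved
  -- along a component. A cycle is recovered only in `unbalanced⇒negative`.
  Unbalanced : Subset size → Fin order → Set
  Unbalanced F v = Walk F true v v

  unbalanced-conn : Walk F s u v → Unbalanced F u → Unbalanced F v
  unbalanced-conn {F} {s} p c = subst (λ b → Walk F b _ _) (lemma s) (walk-trans (walk-trans (walk-sym p) c) p)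
    where
    lemma : ∀ s → (s xor true) xor s ≡ true
    lemma true  = refl
    lemma false = refl

  -- Membership of e in the closure of F in the signed-graphic matroid.
  Spanned : Subset size → Fin size → Set
  Spanned F e = ∃ λ x → ∃ λ y → Joins G e x y × (Walk F (neg e) x y ⊎ (Unbalanced F x × Unbalanced F y))

  spanned-at : ∀ {x y} → Joins G e x y → Spanned F e → Walk F (neg e) x y ⊎ (Unbalanced F x × Unbalanced F y)
  spanned-at j (x′ , y′ , j′ , sp) with joins-unique j′ j
  ... | inj₁ (refl , refl) = sp
  spanned-at j (x′ , y′ , j′ , inj₁ p)         | inj₂ (refl , refl) = inj₁ (walk-sym p)
  spanned-at j (x′ , y′ , j′ , inj₂ (ux , uy)) | inj₂ (refl , refl) = inj₂ (uy , ux)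

  spanned-mono : F ⊆ F′ → Spanned F e → Spanned F′ e
  spanned-mono F⊆ (x , y , j , inj₁ p)         = x , y , j , inj₁ (walk-mono F⊆ p)
  spanned-mono F⊆ (x , y , j , inj₂ (ux , uy)) = x , y , j , inj₂ (walk-mono F⊆ ux , walk-mono F⊆ uy)

  -- Signed union-find

  -- A signed union-find structure: unb is meaningful at representatives only, and the roots are the
  -- representatives of the balanced components.
  record State (F : Subset size) : Set where
    field
      rep       : Fin order → Fin order
      pot       : Fin order → Bool
      unb       : Fin order → Bool
      rep-walk  : ∀ v → Walk F (pot v) v (rep v)
      edge-ok   : ∀ {e u v} → e ∈ F → Joins G e u v → rep u ≡ rep v × (unb (rep u) ≡ true ⊎ neg e ≡ pot u xor pot v)
      unb-sound : ∀ v → unb v ≡ true → Unbalanced F v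
      k         : ℕ
      root      : Fin k → Fin order
      root-inj  : ∀ {i j} → root i ≡ root j → i ≡ j
      root-rep  : ∀ i → rep (root i) ≡ root i
      root-bal  : ∀ i → unb (root i) ≡ false
      root-all  : ∀ v → unb (rep v) ≡ false → ∃ λ i → root i ≡ rep v

    -- In a component that is not marked, `pot` is a switching function: the sign of a walk
    -- telescopes to the difference of the potentials at its ends. In particular its closed walks
    -- are positive.
    walk-ok : Walk F s u v → rep u ≡ rep v × (unb (rep u) ≡ true ⊎ s ≡ pot u xor pot v)
    walk-ok {u = u} nil = refl , inj₂ (sym (xor-same (pot u)))
    walk-ok (cons e e∈ j p) with edge-ok e∈ j | walk-ok p
    ... | eq , inj₁ ub | eq′ , _       = trans eq eq′ , inj₁ ub
    ... | eq , inj₂ _  | eq′ , inj₁ ub = trans eq eq′ , inj₁ (trans (cong unb eq) ub)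
    walk-ok {u = u} {v = v} (cons {w = w} e e∈ j p) | eq , inj₂ σ | eq′ , inj₂ τ =
      trans eq eq′ , inj₂ (trans (cong₂ _xor_ σ τ) (telescope (pot u) (pot w) (pot v)))
      where
      telescope : ∀ a b c → (a xor b) xor (b xor c) ≡ a xor c
      telescope true  true  c = refl
      telescope true  false c = refl
      telescope false true  true = refl
      telescope false true  false = refl
      telescope false false c = refl

    unb-complete : ∀ v → Unbalanced F v → unb (rep v) ≡ true
    unb-complete v c with walk-ok c
    ... | _ , inj₁ ub = ub
    ... | _ , inj₂ eq with trans eq (xor-same (pot v))
    ... | ()

    unb⇒unbalanced : ∀ v → unb (rep v) ≡ true → Unbalanced F v
    unb⇒unbalanced v ub = unbalanced-conn (walk-sym (rep-walk v)) (unb-sound (rep v) ub)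

  empty-state : State ⊥
  empty-state = record
    { rep = id ; pot = λ _ → false ; unb = λ _ → false ; rep-walk = λ _ → nil
    ; edge-ok = λ e∈ → ⊥-elim (∉⊥ e∈) ; unb-sound = λ _ ()
    ; k = order ; root = id ; root-inj = id ; root-rep = λ _ → refl ; root-bal = λ _ → refl ; root-all = λ v _ → v , refl }

  remove-value : ∀ {k} {A : Set} (f : Fin k → A) → (∀ {i j} → f i ≡ f j → i ≡ j) → (i₀ : Fin k) →
    Σ ℕ λ k′ → suc k′ ≡ k × Σ (Fin k′ → A) λ f′ → (∀ {i j} → f′ i ≡ f′ j → i ≡ j)
      × (∀ j → ∃ λ i → f′ j ≡ f i × f i ≢ f i₀) × (∀ i → f i ≢ f i₀ → ∃ λ j → f′ j ≡ f i)
  remove-value {suc k} f f-inj i₀ = k , refl , f ∘ punchIn i₀ , (λ {i} {j} eq → punchIn-injective i₀ i j (f-inj eq)) ,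
    (λ j → punchIn i₀ j , refl , punchInᵢ≢i i₀ j ∘ f-inj) ,
    (λ i fi≢ → punchOut {i = i₀} {j = i} (λ { refl → fi≢ refl }) , cong f (punchIn-punchOut _))

  private
    F⊆F+e : ∀ (F : Subset size) e → F ⊆ F ∪ ⁅ e ⁆
    F⊆F+e F e = p⊆p∪q ⁅ e ⁆

    e∈F+e : ∀ (F : Subset size) e → e ∈ F ∪ ⁅ e ⁆
    e∈F+e F e = q⊆p∪q F ⁅ e ⁆ (x∈⁅x⁆ e)

  edges-of-insertion : ∀ {F e} {P : Fin order → Fin order → Bool → Set} → (∀ {u v σ} → P u v σ → P v u σ) →
    (∀ {f u v} → f ∈ F → Joins G f u v → P u v (neg f)) → ∀ {x y} → Joins G e x y → P x y (neg e) →
    ∀ {f u v} → f ∈ F ∪ ⁅ e ⁆ → Joins G f u v → P u v (neg f)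
  edges-of-insertion {F} {e} P-sym old j new f∈ j′ with x∈p∪q⁻ F ⁅ e ⁆ f∈
  ... | inj₁ f∈F = old f∈F j′
  ... | inj₂ f∈e with refl ← x∈⁅y⁆⇒x≡y e f∈e with joins-unique j j′
  ... | inj₁ (refl , refl) = new
  ... | inj₂ (refl , refl) = P-sym new

  module Insert {F : Subset size} (st : State F) {e : Fin size} {x y : Fin order} (j : Joins G e x y) where
    open State st

    EdgeOk : (Fin order → Fin order) → (Fin order → Bool) → (Fin order → Bool) → Fin order → Fin order → Bool → Set
    EdgeOk rep pot unb u v σ = rep u ≡ rep v × (unb (rep u) ≡ true ⊎ σ ≡ pot u xor pot v)

    edgeOk-sym : ∀ rep pot unb {u v σ} → EdgeOk rep pot unb u v σ → EdgeOk rep pot unb v u σ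
    edgeOk-sym rep pot unb (eq , inj₁ ub) = sym eq , inj₁ (trans (cong unb (sym eq)) ub)
    edgeOk-sym rep pot unb {u} {v} (eq , inj₂ σ) = sym eq , inj₂ (trans σ (xor-comm (pot u) (pot v)))

    edges-ok : ∀ rep′ pot′ unb′ → (∀ {f u v} → f ∈ F → Joins G f u v → EdgeOk rep′ pot′ unb′ u v (neg f)) → EdgeOk rep′ pot′ unb′ x y (neg e) →
      ∀ {f u v} → f ∈ F ∪ ⁅ e ⁆ → Joins G f u v → EdgeOk rep′ pot′ unb′ u v (neg f)
    edges-ok rep′ pot′ unb′ old new = edges-of-insertion {P = EdgeOk rep′ pot′ unb′} (edgeOk-sym rep′ pot′ unb′) old j new

    absorb : rep x ≡ rep y → unb (rep x) ≡ true ⊎ neg e ≡ pot x xor pot y → State (F ∪ ⁅ e ⁆)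
    absorb X≡Y ok = record
      { rep = rep ; pot = pot ; unb = unb
      ; rep-walk = λ v → walk-mono (F⊆F+e F e) (rep-walk v)
      ; edge-ok = edges-ok rep pot unb edge-ok (X≡Y , ok)
      ; unb-sound = λ v ub → walk-mono (F⊆F+e F e) (unb-sound v ub)
      ; k = k ; root = root ; root-inj = root-inj ; root-rep = root-rep ; root-bal = root-bal ; root-all = root-all }

    -- Going along `e` and back through the representative gives a closed walk at `x` of sign
    -- `(neg e xor pot y) xor pot x`, which the failed test makes negative. Only the mark at the
    -- representative changes, and it ceases to be a root.
    unbalance : rep x ≡ rep y → unb (rep x) ≡ false → neg e ≢ pot x xor pot y → Σ (State (F ∪ ⁅ e ⁆)) λ st′ → suc (State.k st′) ≡ k
    unbalance X≡Y bal σ≢ with root-all x bal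
    ... | i₀ , root≡X with remove-value root root-inj i₀
    ... | k′ , eqk , root′ , inj′ , from , to = record
      { rep = rep ; pot = pot ; unb = unb′
      ; rep-walk = λ v → walk-mono (F⊆F+e F e) (rep-walk v)
      ; edge-ok = edges-ok rep pot unb′
          (λ f∈ jf → proj₁ (edge-ok f∈ jf) , [ (λ ub → inj₁ (cong (_∨ _) ub)) , inj₂ ]′ (proj₂ (edge-ok f∈ jf)))
          (X≡Y , inj₁ (trans (cong (unb (rep x) ∨_) (dec-true (rep x Finₚ.≟ rep x) refl)) (∨-zeroʳ _)))
      ; unb-sound = sound
      ; k = k′ ; root = root′ ; root-inj = inj′
      ; root-rep = λ i → let (i′ , eq , _) = from i in trans (cong rep eq) (trans (root-rep i′) (sym eq))
      ; root-bal = bal′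
      ; root-all = all′ } , eqk
      where
      unb′ : Fin order → Bool
      unb′ v = unb v ∨ does (v Finₚ.≟ rep x)
      pot-lemma : ∀ a b c → a ≢ b xor c → (a xor c) xor b ≡ true
      pot-lemma true  true  true  _ = refl
      pot-lemma true  true  false h = ⊥-elim (h refl)
      pot-lemma true  false true  h = ⊥-elim (h refl)
      pot-lemma true  false false _ = refl
      pot-lemma false true  true  h = ⊥-elim (h refl)
      pot-lemma false true  false _ = refl
      pot-lemma false false true  _ = refl
      pot-lemma false false false h = ⊥-elim (h refl)
      unb-x : Unbalanced (F ∪ ⁅ e ⁆) x
      unb-x = subst (λ b → Walk (F ∪ ⁅ e ⁆) b x x) (pot-lemma (neg e) (pot x) (pot y) σ≢)
        (walk-trans (walk-trans (walk-edge (e∈F+e F e) j) (walk-mono (F⊆F+e F e) (subst (Walk F (pot y) y) (sym X≡Y) (rep-walk y))))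
                    (walk-mono (F⊆F+e F e) (walk-sym (rep-walk x))))
      sound : ∀ v → unb′ v ≡ true → Unbalanced (F ∪ ⁅ e ⁆) v
      sound v ub with unb v in eq | v Finₚ.≟ rep x
      ... | true  | _ = walk-mono (F⊆F+e F e) (unb-sound v eq)
      ... | false | yes refl = unbalanced-conn (walk-mono (F⊆F+e F e) (rep-walk x)) unb-x
      sound v () | false | no _
      bal′ : ∀ i → unb′ (root′ i) ≡ false
      bal′ i with from i
      ... | i′ , eq , root≢ with root′ i Finₚ.≟ rep x
      ... | yes ≡X = ⊥-elim (root≢ (trans (sym eq) (trans ≡X (sym root≡X))))
      ... | no _ rewrite eq | root-bal i′ = refl
      all′ : ∀ v → unb′ (rep v) ≡ false → ∃ λ i → root′ i ≡ rep v
      all′ v bv with unb (rep v) in eq | rep v Finₚ.≟ rep x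
      all′ v () | true | _
      all′ v () | false | yes _
      all′ v bv | false | no ≢X with root-all v eq
      ... | i , eqi with to i (λ eq₀ → ≢X (trans (sym eqi) (trans eq₀ root≡X)))
      ... | i′ , eqi′ = i′ , trans eqi′ eqi

    -- The class of `y` is absorbed by that of `x`. Only the mark of the surviving representative
    -- counts afterwards, hence `unb-Y⇒X`. The list of roots is a parameter because it stays as it
    -- is when both classes are unbalanced and otherwise loses the root of `y`.
    module Merge (X≢Y : rep x ≢ rep y) (unb-Y⇒X : unb (rep y) ≡ true → unb (rep x) ≡ true)
      (k′ : ℕ) (root′ : Fin k′ → Fin order) (root′-inj : ∀ {i j} → root′ i ≡ root′ j → i ≡ j)
      (root′-root : ∀ i → ∃ λ i′ → root′ i ≡ root i′ × root i′ ≢ rep y)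
      (root′-all : ∀ v → rep v ≢ rep y → unb (rep v) ≡ false → ∃ λ i → root′ i ≡ rep v) where

      -- The sign of the route from `rep y` through `y`, `e` and `x` to `rep x`.
      shift : Bool
      shift = pot y xor (neg e xor pot x)

      rep′ : Fin order → Fin order
      rep′ v with rep v Finₚ.≟ rep y
      ... | yes _ = rep x
      ... | no  _ = rep v

      pot′ : Fin order → Bool
      pot′ v with rep v Finₚ.≟ rep y
      ... | yes _ = pot v xor shift
      ... | no  _ = pot v

      rep-walk′ : ∀ v → Walk (F ∪ ⁅ e ⁆) (pot′ v) v (rep′ v)
      rep-walk′ v with rep v Finₚ.≟ rep y
      ... | no _ = walk-mono (F⊆F+e F e) (rep-walk v)
      ... | yes eq = walk-trans (walk-mono (F⊆F+e F e) (subst (Walk F (pot v) v) eq (rep-walk v)))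
        (walk-trans (walk-mono (F⊆F+e F e) (walk-sym (rep-walk y)))
        (walk-trans (walk-edge (e∈F+e F e) (joins-sym j)) (walk-mono (F⊆F+e F e) (rep-walk x))))

      old-edge : ∀ {f u v} → f ∈ F → Joins G f u v → EdgeOk rep′ pot′ unb u v (neg f)
      old-edge {f} {u} {v} f∈ jf with edge-ok f∈ jf | rep u Finₚ.≟ rep y | rep v Finₚ.≟ rep y
      ... | eq , ok | yes u≡ | no v≢ = ⊥-elim (v≢ (trans (sym eq) u≡))
      ... | eq , ok | no u≢ | yes v≡ = ⊥-elim (u≢ (trans eq v≡))
      ... | eq , ok | no _ | no _ = eq , ok
      ... | eq , inj₁ ub | yes u≡ | yes _ = refl , inj₁ (unb-Y⇒X (trans (cong unb (sym u≡)) ub))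
      ... | eq , inj₂ σ | yes _ | yes _ = refl , inj₂ (trans σ (shift-lemma (pot u) (pot v) shift))
        where
        shift-lemma : ∀ a b c → a xor b ≡ (a xor c) xor (b xor c)
        shift-lemma true  true  c = sym (xor-same (true xor c))
        shift-lemma true  false true = refl
        shift-lemma true  false false = refl
        shift-lemma false true  true = refl
        shift-lemma false true  false = refl
        shift-lemma false false c = sym (xor-same c)

      new-edge : EdgeOk rep′ pot′ unb x y (neg e)
      new-edge with rep x Finₚ.≟ rep y | rep y Finₚ.≟ rep y
      ... | yes X≡Y | _ = ⊥-elim (X≢Y X≡Y)
      ... | no _ | no Y≢Y = ⊥-elim (Y≢Y refl)
      ... | no _ | yes _ = refl , inj₂ (lemma (neg e) (pot x) (pot y))
        where
        lemma : ∀ a b c → a ≡ b xor (c xor (c xor (a xor b)))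
        lemma true  true  true  = refl
        lemma true  true  false = refl
        lemma true  false true  = refl
        lemma true  false false = refl
        lemma false true  true  = refl
        lemma false true  false = refl
        lemma false false true  = refl
        lemma false false false = refl

      root′-rep : ∀ i → rep′ (root′ i) ≡ root′ i
      root′-rep i with root′-root i
      ... | i′ , eq , ≢Y with rep (root′ i) Finₚ.≟ rep y
      ... | no _ = trans (cong rep eq) (trans (root-rep i′) (sym eq))
      ... | yes ≡Y = ⊥-elim (≢Y (trans (sym (root-rep i′)) (trans (cong rep (sym eq)) ≡Y)))

      all′ : ∀ v → unb (rep′ v) ≡ false → ∃ λ i → root′ i ≡ rep′ v
      all′ v bv with rep v Finₚ.≟ rep y
      ... | yes _ = root′-all x X≢Y bv
      ... | no v≢ = root′-all v v≢ bv

      merged : State (F ∪ ⁅ e ⁆)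
      merged = record
        { rep = rep′ ; pot = pot′ ; unb = unb ; rep-walk = rep-walk′ ; edge-ok = edges-ok rep′ pot′ unb old-edge new-edge
        ; unb-sound = λ v ub → walk-mono (F⊆F+e F e) (unb-sound v ub)
        ; k = k′ ; root = root′ ; root-inj = root′-inj ; root-rep = root′-rep
        ; root-bal = λ i → let (i′ , eq , _) = root′-root i in trans (cong unb eq) (root-bal i′)
        ; root-all = all′ }

    absorb-merge : rep x ≢ rep y → unb (rep x) ≡ true → unb (rep y) ≡ true → Σ (State (F ∪ ⁅ e ⁆)) λ st′ → State.k st′ ≡ k
    absorb-merge X≢Y ux uy = Merge.merged X≢Y (λ _ → ux) k root root-inj
      (λ i → i , refl , λ eq → contradiction (trans (sym uy) (trans (cong unb (sym eq)) (root-bal i))) λ ()) (λ v _ → root-all v) , refl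

    -- Absorbing a balanced class costs exactly one balanced component, whatever the other class is:
    -- the root of `y` disappears and the class of `x` keeps its status.
    join : rep x ≢ rep y → unb (rep y) ≡ false → Σ (State (F ∪ ⁅ e ⁆)) λ st′ → suc (State.k st′) ≡ k
    join X≢Y by with root-all y by
    ... | i₀ , root≡Y with remove-value root root-inj i₀
    ... | k′ , eqk , root′ , inj′ , from , to =
      Merge.merged X≢Y (λ uy → contradiction (trans (sym uy) by) λ ()) k′ root′ inj′
        (λ i → let (i′ , eq , ≢₀) = from i in i′ , eq , λ eqY → ≢₀ (trans eqY (sym root≡Y)))
        (λ v v≢ bv → let (i , eqi) = root-all v bv ; (i′ , eqi′) = to i (λ eq₀ → v≢ (trans (sym eqi) (trans eq₀ root≡Y))) in i′ , trans eqi′ eqi)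
      , eqk

  -- Each case either exhibits the walks that span `e` or refutes them by `walk-ok` and
  -- `unb-complete`. This is the unit increase of the rank, with `Spanned` as closure.
  insert : ∀ {F} (st : State F) e → Σ (State (F ∪ ⁅ e ⁆)) λ st′ →
    (Spanned F e × State.k st′ ≡ State.k st) ⊎ (¬ Spanned F e × suc (State.k st′) ≡ State.k st)
  insert {F} st e with rep x Finₚ.≟ rep y | unb (rep x) in ux | unb (rep y) in uy | neg e Boolₚ.≟ pot x xor pot y
    where
    open State st
    x = proj₁ (ends e)
    y = proj₂ (ends e)
  ... | yes X≡Y | true | _ | _ = absorb X≡Y (inj₁ ux) , inj₁ ((_ , _ , inj₁ refl , inj₂ (unb⇒unbalanced _ ux , unb⇒unbalanced _ (trans (cong unb (sym X≡Y)) ux))) , refl)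
    where
    open State st
    open Insert st {e} (inj₁ refl)
  ... | yes X≡Y | false | _ | yes σ = absorb X≡Y (inj₂ σ) , inj₁ ((_ , _ , inj₁ refl , inj₁ (subst (λ b → Walk F b _ _) (sym σ)
          (walk-trans (rep-walk _) (walk-sym (subst (Walk F _ _) (sym X≡Y) (rep-walk _)))))) , refl)
    where
    open State st
    open Insert st {e} (inj₁ refl)
  ... | yes X≡Y | false | _ | no σ≢ = let (st′ , eqk) = unbalance X≡Y ux σ≢ in st′ , inj₂ ((λ sp → not-spanned (spanned-at (inj₁ refl) sp)) , eqk)
    where
    open State st
    open Insert st {e} (inj₁ refl)
    not-spanned : Walk F (neg e) _ _ ⊎ (Unbalanced F _ × Unbalanced F _) → Data.Empty.⊥
    not-spanned (inj₁ p) with walk-ok p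
    ... | _ , inj₂ σ = σ≢ σ
    ... | _ , inj₁ ub with trans (sym ux) ub
    ... | ()
    not-spanned (inj₂ (cx , _)) with trans (sym ux) (unb-complete _ cx)
    ... | ()
  ... | no X≢Y | true | true | _ = let (st′ , eqk) = absorb-merge X≢Y ux uy in
          st′ , inj₁ ((_ , _ , inj₁ refl , inj₂ (unb⇒unbalanced _ ux , unb⇒unbalanced _ uy)) , eqk)
    where
    open State st
    open Insert st {e} (inj₁ refl)
  ... | no X≢Y | _ | false | _ = let (st′ , eqk) = join X≢Y uy in st′ , inj₂ ((λ sp → not-spanned (spanned-at (inj₁ refl) sp)) , eqk)
    where
    open State st
    open Insert st {e} (inj₁ refl)
    not-spanned : Walk F (neg e) _ _ ⊎ (Unbalanced F _ × Unbalanced F _) → Data.Empty.⊥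
    not-spanned (inj₁ p) = X≢Y (proj₁ (walk-ok p))
    not-spanned (inj₂ (_ , cy)) with trans (sym uy) (unb-complete _ cy)
    ... | ()
  -- Here the class of `x` is the balanced one, so `e` is read in the opposite direction to let that
  -- class be absorbed.
  ... | no X≢Y | false | true | _ = let (st′ , eqk) = join (X≢Y ∘ sym) ux in st′ , inj₂ ((λ sp → not-spanned (spanned-at (inj₁ refl) sp)) , eqk)
    where
    open State st
    open Insert st {e} (inj₂ refl)
    not-spanned : Walk F (neg e) _ _ ⊎ (Unbalanced F _ × Unbalanced F _) → Data.Empty.⊥
    not-spanned (inj₁ p) = X≢Y (proj₁ (walk-ok p))
    not-spanned (inj₂ (cx , _)) with trans (sym ux) (unb-complete _ cx)
    ... | ()

  state : ∀ F → State F
  state = subset-induction State empty-state λ F e _ st → proj₁ (insert st e)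

-- Parity and the signs of cycles

odd : ℕ → Bool
odd zero    = false
odd (suc n) = not (odd n)

odd-+ : ∀ a b → odd (a + b) ≡ odd a xor odd b
odd-+ zero    b = refl
odd-+ (suc a) b with odd a | odd b | odd-+ a b
... | true  | _ | eq = trans (cong not eq) (Boolₚ.not-involutive _)
... | false | _ | eq = cong not eq

%2-odd : ∀ n → n % 2 ≡ (if odd n then 1 else 0)
%2-odd zero = refl
%2-odd (suc zero) = refl
%2-odd (suc (suc n)) = trans (%2-odd n) (cong (if_then 1 else 0) (sym (Boolₚ.not-involutive (odd n))))

xor-cancel : ∀ a b c → b xor a ≡ false → a xor (b xor c) ≡ c
xor-cancel true  true  c _ = Boolₚ.not-involutive c
xor-cancel false false c _ = refl

module Cycles (G : SGraph) where
  open SGraph G renaming (n to order; m to size)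
  open SignedWalks G
  open Cycle

  private variable
    F F′ : Subset size
    s s′ : Bool
    u v : Fin order

  sign : ∀ {k} → (Fin k → Fin size) → Bool
  sign {zero}  es = false
  sign {suc k} es = neg (es zero) xor sign (es ∘ suc)

  odd-negSum : ∀ {k} (es : Fin k → Fin size) → odd (sum (map (λ i → if neg (es i) then 1 else 0) (allFin k))) ≡ sign es
  odd-negSum {zero} es = refl
  odd-negSum {suc k} es = begin
    odd (b (es zero) + sum (map (b ∘ es) (Data.List.tabulate suc)))   ≡⟨ odd-+ (b (es zero)) _ ⟩
    odd (b (es zero)) xor odd (sum (map (b ∘ es) (Data.List.tabulate suc)))
      ≡⟨ cong₂ _xor_ (odd-b (es zero)) (cong (odd ∘ sum) (trans (Listₚ.map-tabulate suc (b ∘ es)) (sym (Listₚ.map-tabulate id (b ∘ es ∘ suc))))) ⟩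
    neg (es zero) xor odd (sum (map (b ∘ es ∘ suc) (allFin k)))       ≡⟨ cong (neg (es zero) xor_) (odd-negSum (es ∘ suc)) ⟩
    sign es                                                            ∎
    where
    open ≡-Reasoning
    b : Fin size → ℕ
    b e = if neg e then 1 else 0
    odd-b : ∀ e → odd (b e) ≡ neg e
    odd-b e with neg e
    ... | true  = refl
    ... | false = refl

  %2-sign : ∀ C → negCount G C % 2 ≡ (if sign (es C) then 1 else 0)
  %2-sign C = trans (%2-odd (negCount G C)) (cong (if_then 1 else 0) (odd-negSum (es C)))

  negative⇒sign : ∀ C → NegativeCycle G C → sign (es C) ≡ true
  negative⇒sign C neg′ with sign (es C) | trans (sym neg′) (%2-sign C)
  ... | true  | _ = refl
  ... | false | ()

  sign⇒negative : ∀ C → sign (es C) ≡ true → NegativeCycle G C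
  sign⇒negative C eq = trans (%2-sign C) (cong (if_then 1 else 0) eq)

  sign⇒positive : ∀ C → sign (es C) ≡ false → PositiveCycle G C
  sign⇒positive C eq = trans (%2-sign C) (cong (if_then 1 else 0) eq)

  negative⇒¬positive : ∀ C → NegativeCycle G C → ¬ PositiveCycle G C
  negative⇒¬positive C n p with trans (sym n) p
  ... | ()

  -- A cycle whose return vertex is released to a free `z`; the tail of a chain is again a chain,
  -- which permits recursion on the length.
  Chain : ∀ {k} → (Fin (suc k) → Fin order) → (Fin (suc k) → Fin size) → Fin order → Set
  Chain {k} vs es z = ((i : Fin k) → Joins G (es (inject₁ i)) (vs (inject₁ i)) (vs (suc i)))
    × Joins G (es (fromℕ k)) (vs (fromℕ k)) z

  chain : (C : Cycle G) → Chain (vs C) (es C) (vs C zero)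
  chain C = joins C , closes C

  chain-walk : ∀ {k} vs es {z} → Chain {k} vs es z → (∀ i → es i ∈ F) → Walk F (sign es) (vs zero) z
  chain-walk {k = zero}  vs es (_  , cl) es∈ = cons (es zero) (es∈ zero) cl nil
  chain-walk {k = suc k} vs es (js , cl) es∈ =
    cons (es zero) (es∈ zero) (js zero) (chain-walk (vs ∘ suc) (es ∘ suc) (js ∘ suc , cl) (es∈ ∘ suc))

  chain-prefix : ∀ {k} vs es {z} → Chain {k} vs es z → (∀ i → es i ∈ F) → ∀ i → Conn G F (vs zero) (vs i)
  chain-prefix vs es ch es∈ zero = here
  chain-prefix {k = suc k} vs es (js , cl) es∈ (suc i) =
    step (es zero) (es∈ zero) (js zero) (chain-prefix (vs ∘ suc) (es ∘ suc) (js ∘ suc , cl) (es∈ ∘ suc) i)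

  -- Only the other edges need to lie in `F`. For a cycle, `z` is the starting vertex, and the
  -- second walk followed by the first connects the ends of the removed edge around the cycle.
  chain-cut : ∀ {k} vs es {z} → Chain {k} vs es z → ∀ i → (∀ j → j ≢ i → es j ∈ F) →
    ∃ λ a → ∃ λ b → ∃ λ s₁ → ∃ λ s₂ → Joins G (es i) a b × Walk F s₁ (vs zero) a × Walk F s₂ b z × sign es ≡ s₁ xor (neg (es i) xor s₂)
  chain-cut {k = zero} vs es (_ , cl) zero es∈ = _ , _ , _ , _ , cl , nil , nil , refl
  chain-cut {k = suc k} vs es (js , cl) zero es∈ = _ , _ , _ , _ , js zero , nil ,
    chain-walk (vs ∘ suc) (es ∘ suc) (js ∘ suc , cl) (λ i → es∈ (suc i) λ ()) , refl
  chain-cut {k = suc k} vs es (js , cl) (suc i) es∈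
    with chain-cut (vs ∘ suc) (es ∘ suc) (js ∘ suc , cl) i (λ j j≢i → es∈ (suc j) (j≢i ∘ Finₚ.suc-injective))
  ... | a , b , s₁ , s₂ , j , p , q , eq = a , b , _ , s₂ , j , cons (es zero) (es∈ zero λ ()) (js zero) p , q ,
    trans (cong (neg (es zero) xor_) eq) (sym (xor-assoc (neg (es zero)) s₁ _))

  cycle-conn : ∀ C → CycleIn G F C → ∀ i → Conn G F (vs C zero) (vs C i)
  cycle-conn C = chain-prefix (vs C) (es C) (chain C)

  negative⇒unbalanced : ∀ {F} C → CycleInCompOf G F v C → NegativeCycle G C → Unbalanced F v
  negative⇒unbalanced {F = F} C (C⊆F , i , v~i) neg-C =
    unbalanced-conn (proj₂ (conn⇒walk (conn-trans (cycle-conn C C⊆F i) (conn-sym v~i))))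
      (subst (λ b → Walk F b (vs C zero) (vs C zero)) (negative⇒sign C neg-C) (chain-walk (vs C) (es C) (chain C) C⊆F))

  -- Extracting cycles from walks

  length : Walk F s u v → ℕ
  length nil            = 0
  length (cons _ _ _ w) = suc (length w)

  vertex : (w : Walk F s u v) → Fin (suc (length w)) → Fin order
  vertex {u = u} nil            zero    = u
  vertex {u = u} (cons _ _ _ w) zero    = u
  vertex         (cons _ _ _ w) (suc i) = vertex w i

  -- The last index carries the closing edge `f`, so that vertices and edges are numbered alike, as
  -- `Cycle` demands.
  edge : (w : Walk F s u v) → Fin size → Fin (suc (length w)) → Fin size
  edge nil            f zero    = f
  edge (cons e _ _ w) f zero    = e
  edge (cons _ _ _ w) f (suc i) = edge w f i

  vertex-zero : (w : Walk F s u v) → vertex w zero ≡ u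
  vertex-zero nil            = refl
  vertex-zero (cons _ _ _ w) = refl

  vertex-last : (w : Walk F s u v) → vertex w (fromℕ (length w)) ≡ v
  vertex-last nil            = refl
  vertex-last (cons _ _ _ w) = vertex-last w

  Simple : Walk F s u v → Set
  Simple nil                    = Unit
  Simple (cons {u = u} _ _ _ w) = (∀ i → vertex w i ≢ u) × Simple w

  Avoids : Fin size → Walk F s u v → Set
  Avoids f nil            = Unit
  Avoids f (cons e _ _ w) = e ≢ f × Avoids f w

  vertex-injective : (w : Walk F s u v) → Simple w → Injective _≡_ _≡_ (vertex w)
  vertex-injective nil sm {zero} {zero} eq = refl
  vertex-injective (cons _ _ _ w) sm {zero} {zero} eq = refl
  vertex-injective (cons _ _ _ w) (fresh , sm) {zero} {suc j} eq = ⊥-elim (fresh j (sym eq))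
  vertex-injective (cons _ _ _ w) (fresh , sm) {suc i} {zero} eq = ⊥-elim (fresh i eq)
  vertex-injective (cons _ _ _ w) (fresh , sm) {suc i} {suc j} eq = cong suc (vertex-injective w sm eq)

  edge-chain : ∀ (w : Walk F s u v) {f z} → Joins G f v z → Chain (vertex w) (edge w f) z
  edge-chain w j = js w , cl w j
    where
    js : ∀ {f} (w : Walk F s u v) (i : Fin (length w)) → Joins G (edge w f (inject₁ i)) (vertex w (inject₁ i)) (vertex w (suc i))
    js (cons e _ j w) zero    = subst (Joins G e _) (sym (vertex-zero w)) j
    js (cons e _ j w) (suc i) = js w i
    cl : ∀ {f z} (w : Walk F s u v) → Joins G f v z → Joins G (edge w f (fromℕ (length w))) (vertex w (fromℕ (length w))) z
    cl nil            j = j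
    cl (cons _ _ _ w) j = cl w j

  edge-touches : ∀ (w : Walk F s u v) f i → edge w f i ≡ f ⊎ (∃ λ a → ∃ λ b → Joins G (edge w f i) (vertex w a) (vertex w b))
  edge-touches nil f zero = inj₁ refl
  edge-touches (cons e _ j w) f zero = inj₂ (zero , suc zero , subst (Joins G e _) (sym (vertex-zero w)) j)
  edge-touches (cons e _ j w) f (suc i) with edge-touches w f i
  ... | inj₁ eq = inj₁ eq
  ... | inj₂ (a , b , j′) = inj₂ (suc a , suc b , j′)

  -- The first edge is incident with `u`, whereas every later edge of the walk joins vertices
  -- distinct from `u`; the closing edge is excluded by `Avoids`.
  edge-injective : ∀ (w : Walk F s u v) {f} → Simple w → Avoids f w → Injective _≡_ _≡_ (edge w f)
  edge-injective nil sm av {zero} {zero} eq = refl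
  edge-injective (cons e _ j w) sm av {zero} {zero} eq = refl
  edge-injective (cons e _ j w) (fresh , sm) (e≢f , av) {suc a} {suc b} eq = cong suc (edge-injective w sm av eq)
  edge-injective {u = u} (cons {w = x} e _ j w) {f} (fresh , sm) (e≢f , av) {zero} {suc b} eq = ⊥-elim (first≢ b eq)
    where
    first≢ : ∀ b → e ≢ edge w f b
    first≢ b eq with edge-touches w f b
    ... | inj₁ ≡f = e≢f (trans eq ≡f)
    ... | inj₂ (a₁ , a₂ , j′) with joins-unique (subst (λ d → Joins G d _ _) (sym eq) j′) j
    ... | inj₁ (u≡ , _) = fresh a₁ (sym u≡)
    ... | inj₂ (u≡ , _) = fresh a₂ (sym u≡)
  edge-injective {u = u} W@(cons e _ j w) {f} sm av {suc b} {zero} eq = sym (edge-injective W sm av {zero} {suc b} (sym eq))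

  edge∈ : ∀ (w : Walk F s u v) {f} → f ∈ F → ∀ i → edge w f i ∈ F
  edge∈ nil             f∈ zero    = f∈
  edge∈ (cons e e∈ _ w) f∈ zero    = e∈
  edge∈ (cons e e∈ _ w) f∈ (suc i) = edge∈ w f∈ i

  sign-edge : ∀ (w : Walk F s u v) f → sign (edge w f) ≡ s xor neg f
  sign-edge nil f = Boolₚ.xor-identityʳ (neg f)
  sign-edge (cons {s = s} e _ _ w) f = trans (cong (neg e xor_) (sign-edge w f)) (sym (xor-assoc (neg e) s (neg f)))

  close : ∀ (w : Walk F s u v) {f} → Simple w → Avoids f w → f ∈ F → Joins G f v u →
    Σ (Cycle G) λ C → CycleIn G F C × vs C zero ≡ u × sign (es C) ≡ s xor neg f
  close w {f} sm av f∈ j = record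
    { len = length w ; vs = vertex w ; es = edge w f
    ; vs-inj = vertex-injective w sm ; es-inj = edge-injective w sm av
    ; joins = proj₁ (edge-chain w j) ; closes = subst (Joins G _ _) (sym (vertex-zero w)) (proj₂ (edge-chain w j)) }
    , edge∈ w f∈ , vertex-zero w , sign-edge w f

  split : ∀ (w : Walk F s u v) → Simple w → ∀ i →
    ∃ λ s₁ → ∃ λ s₂ → Σ (Walk F s₁ u (vertex w i)) λ p → Σ (Walk F s₂ (vertex w i) v) λ q →
      Simple p × Simple q × s ≡ s₁ xor s₂ × (∀ k → ∃ λ k′ → vertex p k ≡ vertex w k′)
  split nil sm zero = _ , _ , nil , nil , tt , tt , refl , λ k → k , refl
  split w@(cons _ _ _ _) sm zero = _ , _ , nil , w , tt , sm , refl , λ { zero → zero , refl }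
  split (cons e e∈ j w) (fresh , sm) (suc i) with split w sm i
  ... | s₁ , s₂ , p , q , sp , sq , eq , sub = _ , s₂ , cons e e∈ j p , q ,
    ((λ k eq′ → fresh (proj₁ (sub k)) (trans (sym (proj₂ (sub k))) eq′)) , sp) , sq ,
    trans (cong (neg e xor_) eq) (sym (xor-assoc (neg e) s₁ s₂)) ,
    λ { zero → zero , refl ; (suc k) → suc (proj₁ (sub k)) , proj₂ (sub k) }

  simple-closed : (w : Walk F s u v) → Simple w → u ≡ v → s ≡ false
  simple-closed nil sm eq = refl
  simple-closed (cons _ _ _ w) (fresh , _) refl = ⊥-elim (fresh _ (vertex-last w))

  avoids-fresh : ∀ {f a b} (w : Walk F s u v) → (∀ i → vertex w i ≢ a) → Joins G f a b → Avoids f w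
  avoids-fresh nil fresh j = tt
  avoids-fresh (cons e _ j′ w) fresh j = (λ { refl → clash (joins-unique j′ j) }) , avoids-fresh w (fresh ∘ suc) j
    where
    clash : _ → Data.Empty.⊥
    clash (inj₁ (a≡ , _)) = fresh zero (sym a≡)
    clash (inj₂ (a≡ , _)) = fresh (suc zero) (trans (vertex-zero w) (sym a≡))

  -- A simple walk between the ends of `f` can use `f` only as its sole edge. This separates genuine
  -- cycles from going along an edge and straight back.
  avoids-or-edge : ∀ {f} (w : Walk F s u v) → Simple w → Joins G f u v → Avoids f w ⊎ s ≡ neg f
  avoids-or-edge nil sm j = inj₁ tt
  avoids-or-edge {f = f} (cons e e∈ j′ w) (fresh , sm) j with e Finₚ.≟ f
  ... | no e≢f = inj₁ (e≢f , avoids-fresh w fresh j)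
  ... | yes refl with joins-unique j′ j
  ... | inj₂ (u≡ , _) = ⊥-elim (fresh zero (trans (vertex-zero w) (sym u≡)))
  ... | inj₁ (_ , v≡) = inj₂ (trans (cong (neg f xor_) (simple-closed w sm (sym v≡))) (Boolₚ.xor-identityʳ (neg f)))

  NegativeCycleNear : Subset size → Fin order → Set
  NegativeCycleNear F v = Σ (Cycle G) λ C → CycleInCompOf G F v C × NegativeCycle G C

  -- Erasing a positive loop does not change the sign of a walk.
  erase-loops : Walk F s u v → NegativeCycleNear F u ⊎ Σ (Walk F s u v) Simple
  erase-loops nil = inj₂ (nil , tt)
  erase-loops {F = F} {u = u} {v = v} (cons {s = s} e e∈ j w₀) with erase-loops w₀
  ... | inj₁ (C , (C⊆ , i , conn) , neg-C) = inj₁ (C , (C⊆ , i , step e e∈ j conn) , neg-C)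
  ... | inj₂ (w , sm) with any? (λ i → vertex w i Finₚ.≟ u)
  ... | no ¬i = inj₂ (cons e e∈ j w , (λ i eq → ¬i (i , eq)) , sm)
  ... | yes (i , refl) with split w sm i
  ... | s₁ , s₂ , p , q , sp , sq , eq , _ with avoids-or-edge p sp (joins-sym j)
  -- Going along `e` and back is no cycle, but its sign cancels, so the detour is dropped like a
  -- positive loop.
  ... | inj₂ s₁≡ = inj₂ (subst (λ b → Σ (Walk F b u v) Simple)
          (sym (trans (cong (neg e xor_) eq) (xor-cancel (neg e) s₁ s₂ (trans (cong (_xor neg e) s₁≡) (xor-same (neg e)))))) (q , sq))
  ... | inj₁ av with close p sp av e∈ j
  ... | C , C⊆ , C₀ , sg with s₁ xor neg e in par
  ... | true = inj₁ (C , (C⊆ , zero , subst (Conn G F u) (sym C₀) (step e e∈ j here)) , sign⇒negative C sg)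
  ... | false = inj₂ (subst (λ b → Σ (Walk F b u v) Simple) (sym (trans (cong (neg e xor_) eq) (xor-cancel (neg e) s₁ s₂ par))) (q , sq))

  -- A simple closed walk is empty and hence positive, so erasing loops from a negative closed walk
  -- must run into a negative cycle.
  unbalanced⇒negative : Unbalanced F v → NegativeCycleNear F v
  unbalanced⇒negative c with erase-loops c
  ... | inj₁ near = near
  ... | inj₂ (w , sm) with simple-closed w sm refl
  ... | ()

-- The signed-graphic matroid and its bases

module SignedGraphicMatroid (G : SGraph) where
  open SGraph G renaming (n to order; m to size)
  open SignedWalks G
  open Cycles G
  open Cycle

  balanced-or-unbalanced : ∀ {F} → State F → ∀ v → BalancedComp G F v ⊎ Unbalanced F v
  balanced-or-unbalanced {F} st v with unb (rep v) in eq
    where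
    open State st
  ... | true  = inj₂ (State.unb⇒unbalanced st v eq)
  ... | false = inj₁ positive
    where
    positive : BalancedComp G F v
    positive C C∈ with sign (es C) in sg
    ... | false = sign⇒positive C sg
    ... | true with trans (sym eq) (State.unb-complete st v (negative⇒unbalanced C C∈ (sign⇒negative C sg)))
    ... | ()

  unbalanced⇒¬balanced : ∀ {F v} → Unbalanced F v → ¬ BalancedComp G F v
  unbalanced⇒¬balanced c bal with unbalanced⇒negative c
  ... | C , C∈ , neg-C = negative⇒¬positive C neg-C (bal C C∈)

  state⇒BCount : ∀ {F} (st : State F) → BCount G F (State.k st)
  state⇒BCount {F} st = root , separated , balanced , complete
    where
    open State st
    separated : ∀ i j → Conn G F (root i) (root j) → i ≡ j
    separated i j c = root-inj (trans (sym (root-rep i)) (trans (proj₁ (walk-ok (proj₂ (conn⇒walk c)))) (root-rep j)))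
    balanced : ∀ i → BalancedComp G F (root i)
    balanced i with balanced-or-unbalanced st (root i)
    ... | inj₁ bal = bal
    ... | inj₂ c with trans (sym (root-bal i)) (trans (cong unb (sym (root-rep i))) (unb-complete (root i) c))
    ... | ()
    complete : ∀ v → BalancedComp G F v → Σ (Fin k) λ i → Conn G F v (root i)
    complete v bal with unb (rep v) in eq
    ... | true = ⊥-elim (unbalanced⇒¬balanced (unb⇒unbalanced v eq) bal)
    ... | false with root-all v eq
    ... | i , root≡ = i , subst (Conn G F v) (sym root≡) (walk⇒conn (rep-walk v))

  BCount-unique : ∀ {F k k′} → BCount G F k → BCount G F k′ → k ≡ k′
  BCount-unique B B′ = ≤-antisym (half B B′) (half B′ B)
    where
    half : ∀ {F k k′} → BCount G F k → BCount G F k′ → k ≤ k′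
    half (r , sep , bal , _) (r′ , _ , _ , com′) = injective⇒≤ {f = λ i → proj₁ (com′ (r i) (bal i))}
      λ {i} {j} eq → sep i j (conn-trans (proj₂ (com′ (r i) (bal i)))
        (conn-sym (subst (λ z → Conn G _ (r j) (r′ z)) (sym eq) (proj₂ (com′ (r j) (bal j))))))

  abstract
    b : Subset size → ℕ
    b F = State.k (state F)

    bcount : ∀ F → BCount G F (b F)
    bcount F = state⇒BCount (state F)

    b-insert : ∀ F e → (Spanned F e × b (F ∪ ⁅ e ⁆) ≡ b F) ⊎ (¬ Spanned F e × suc (b (F ∪ ⁅ e ⁆)) ≡ b F)
    b-insert F e with insert (state F) e
    ... | st′ , inj₁ (sp , eq) = inj₁ (sp , trans (BCount-unique (bcount _) (state⇒BCount st′)) eq)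
    ... | st′ , inj₂ (¬sp , eq) = inj₂ (¬sp , trans (cong suc (BCount-unique (bcount _) (state⇒BCount st′))) eq)

  b-⊥ : b ⊥ ≡ order
  b-⊥ = BCount-unique (bcount ⊥) (state⇒BCount empty-state)

  b≤order : ∀ F → b F ≤ order
  b≤order F with bcount F
  ... | r , sep , _ = injective⇒≤ {f = r} λ {i} {j} eq → sep i j (subst (Conn G F (r i)) eq here)

  all-unbalanced⇒b≡0 : ∀ {F} → (∀ v → Unbalanced F v) → b F ≡ 0
  all-unbalanced⇒b≡0 {F} unb with b F | bcount F
  ... | zero  | _ = refl
  ... | suc _ | r , _ , bal , _ = ⊥-elim (unbalanced⇒¬balanced (unb (r zero)) (bal zero))

  b≡0⇒all-unbalanced : ∀ {F} → b F ≡ 0 → ∀ v → Unbalanced F v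
  b≡0⇒all-unbalanced {F} b≡0 v with balanced-or-unbalanced (state F) v
  ... | inj₂ c = c
  ... | inj₁ bal with b F | bcount F
  ...   | zero | _ , _ , _ , com with com v bal
  ...     | () , _
  b≡0⇒all-unbalanced () v | inj₁ bal | suc _ | _

  rk : Subset size → ℕ
  rk F = order ∸ b F

  rk+b : ∀ F → rk F + b F ≡ order
  rk+b F = m∸n+n≡m (b≤order F)

  rk-insert : ∀ F e → (Spanned F e × rk (F ∪ ⁅ e ⁆) ≡ rk F) ⊎ (¬ Spanned F e × rk (F ∪ ⁅ e ⁆) ≡ suc (rk F))
  rk-insert F e with b-insert F e
  ... | inj₁ (sp , eq) = inj₁ (sp , cong (order ∸_) eq)
  ... | inj₂ (¬sp , eq) = inj₂ (¬sp , +-cancelʳ-≡ (b (F ∪ ⁅ e ⁆)) _ _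
    (trans (rk+b (F ∪ ⁅ e ⁆)) (trans (sym (rk+b F)) (trans (cong (rk F +_) (sym eq)) (+-suc _ _)))))

  rk≤rk-insert : ∀ F e → rk F ≤ rk (F ∪ ⁅ e ⁆)
  rk≤rk-insert F e with rk-insert F e
  ... | inj₁ (_ , eq) = ≤-reflexive (sym eq)
  ... | inj₂ (_ , eq) = ≤-trans (n≤1+n _) (≤-reflexive (sym eq))

  rk-insert≤ : ∀ F e → rk (F ∪ ⁅ e ⁆) ≤ suc (rk F)
  rk-insert≤ F e with rk-insert F e
  ... | inj₁ (_ , eq) = ≤-trans (≤-reflexive eq) (n≤1+n _)
  ... | inj₂ (_ , eq) = ≤-reflexive eq

  -- An edge gains rank 0 if it is spanned and 1 if not. By `spanned-mono` an edge spanned by `A` is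
  -- spanned by `B`, so the gain cannot grow with the set.
  rk-diminishing₁ : ∀ {A B} e → A ⊆ B → rk (B ∪ ⁅ e ⁆) + rk A ≤ rk B + rk (A ∪ ⁅ e ⁆)
  rk-diminishing₁ {A} {B} e A⊆B with rk-insert A e | rk-insert B e
  ... | _ | inj₁ (_ , eq) = +-mono-≤ (≤-reflexive eq) (rk≤rk-insert A e)
  ... | inj₁ (sp , _) | inj₂ (¬sp , _) = ⊥-elim (¬sp (spanned-mono A⊆B sp))
  ... | inj₂ (_ , eqA) | inj₂ (_ , eqB) = ≤-reflexive (trans (cong (_+ rk A) eqB) (trans (sym (+-suc (rk B) (rk A))) (cong (rk B +_) (sym eqA))))

  rk-diminishing : ∀ {A B} → A ⊆ B → ∀ D → rk (B ∪ D) + rk A ≤ rk B + rk (A ∪ D)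
  rk-diminishing {A} {B} A⊆B = subset-induction _
    (≤-reflexive (cong₂ (λ P Q → rk P + rk Q) (∪-identityʳ B) (sym (∪-identityʳ A))))
    λ D e _ ih → subst₂ (λ P Q → rk P + rk A ≤ rk B + rk Q) (∪-assoc B D ⁅ e ⁆) (∪-assoc A D ⁅ e ⁆)
      (combine-bounds {rk ((B ∪ D) ∪ ⁅ e ⁆)} {rk A} {rk B} {rk (A ∪ D)} {rk (B ∪ D)} ih (rk-diminishing₁ e (∪-monoˡ-⊆ D A⊆B)))
    where
    combine-bounds : ∀ {x a b c d y} → d + a ≤ b + c → x + c ≤ d + y → x + a ≤ b + y
    combine-bounds {x} {a} {b} {c} {d} {y} h₁ h₂ = +-cancelʳ-≤ (c + d) _ _ (begin
      (x + a) + (c + d)  ≡⟨ s₁ x a c d ⟩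
      (x + c) + (d + a)  ≤⟨ +-mono-≤ h₂ h₁ ⟩
      (d + y) + (b + c)  ≡⟨ s₂ d y b c ⟩
      (b + y) + (c + d)  ∎)
      where
      open ≤-Reasoning
      s₁ : ∀ x a c d → (x + a) + (c + d) ≡ (x + c) + (d + a)
      s₁ = solve-∀
      s₂ : ∀ d y b c → (d + y) + (b + c) ≡ (b + y) + (c + d)
      s₂ = solve-∀

  rk≤rk-∪ : ∀ A D → rk A ≤ rk (A ∪ D)
  rk≤rk-∪ A = subset-induction _ (≤-reflexive (cong rk (sym (∪-identityʳ A))))
    λ D e _ ih → ≤-trans ih (≤-trans (rk≤rk-insert (A ∪ D) e) (≤-reflexive (cong rk (∪-assoc A D ⁅ e ⁆))))

  rk-isRankFunction : IsRankFunction rk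
  rk-isRankFunction = record
    { mono = λ {A} {B} A⊆B → ≤-trans (rk≤rk-∪ A B) (≤-reflexive (cong rk (⊆-antisym (∪-⊆ A⊆B id) (q⊆p∪q A B))))
    ; submodular = λ A B → begin
        rk (A ∪ B) + rk (A ∩ B)        ≤⟨ rk-diminishing (p∩q⊆p A B) B ⟩
        rk A + rk (A ∩ B ∪ B)          ≡⟨ cong (λ P → rk A + rk P) (⊆-antisym (∪-⊆ (p∩q⊆q A B) id) (q⊆p∪q (A ∩ B) B)) ⟩
        rk A + rk B                    ∎
    ; bounded = subset-induction _ (≤-reflexive (trans (cong (order ∸_) b-⊥) (trans (n∸n≡0 order) (sym (∣⊥∣≡0 size)))))
        λ F e e∉F ih → ≤-trans (rk-insert≤ F e) (≤-trans (s≤s ih) (≤-reflexive (sym (x∉p⇒∣p∪⁅x⁆∣≡1+∣p∣ F e∉F)))) }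
    where
    open ≤-Reasoning

  open IsRankFunction rk-isRankFunction

  unicyclic⇒b≡0 : ∀ {U} → SignedUnicyclic G U → b U ≡ 0
  unicyclic⇒b≡0 (has , _ , negative) = all-unbalanced⇒b≡0 λ v → let (C , C∈) = has v in negative⇒unbalanced C C∈ (negative C (proj₁ C∈))

  -- `U` has full rank, `F` falls short of it by `b F`, and each edge of `U` outside `F` supplies at
  -- most one unit of rank.
  b≤∣unicyclic─∣ : ∀ {U} → SignedUnicyclic G U → ∀ F → b F ≤ ∣ U ─ F ∣
  b≤∣unicyclic─∣ {U} su F = +-cancelˡ-≤ (rk F) _ _ (begin
    rk F + b F                 ≡⟨ rk+b F ⟩
    order                      ≡⟨ rk+b U ⟨
    rk U + b U                 ≡⟨ cong (rk U +_) (unicyclic⇒b≡0 su) ⟩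
    rk U + 0                   ≡⟨ +-identityʳ _ ⟩
    rk U                       ≤⟨ mono U⊆ ⟩
    rk (F ∪ (U ─ F))           ≤⟨ m≤m+n _ _ ⟩
    rk (F ∪ (U ─ F)) + rk (F ∩ (U ─ F)) ≤⟨ submodular F (U ─ F) ⟩
    rk F + rk (U ─ F)          ≤⟨ +-monoʳ-≤ (rk F) (bounded (U ─ F)) ⟩
    rk F + ∣ U ─ F ∣           ∎)
    where
    open ≤-Reasoning
    U⊆ : U ⊆ F ∪ (U ─ F)
    U⊆ {x} x∈ with x ∈? F
    ... | yes x∈F = p⊆p∪q _ x∈F
    ... | no x∉F = q⊆p∪q F _ (x∈p∧x∉q⇒x∈p─q x∈ x∉F)

  module _ {U : Subset size} (rk-U : rk U ≡ order) (∣U∣ : ∣ U ∣ ≡ order) where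

    -- Deleting a spanned edge would leave full rank on fewer than `order` edges.
    not-spanned : ∀ {e} → e ∈ U → ¬ Spanned (U - e) e
    not-spanned {e} e∈ sp with rk-insert (U - e) e
    ... | inj₂ (¬sp , _) = ¬sp sp
    ... | inj₁ (_ , eq) = <⇒≢ (begin-strict
      rk U                  ≡⟨ cong rk (x∈p⇒[p-x]∪⁅x⁆≡p U e∈) ⟨
      rk ((U - e) ∪ ⁅ e ⁆)  ≡⟨ eq ⟩
      rk (U - e)            ≤⟨ bounded (U - e) ⟩
      ∣ U - e ∣             <⟨ x∈p⇒∣p-x∣<∣p∣ e∈ ⟩
      ∣ U ∣                 ∎) (trans rk-U (sym ∣U∣))
      where
      open ≤-Reasoning

    rest∈ : ∀ C → CycleIn G U C → ∀ i j → j ≢ i → es C j ∈ U - es C i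
    rest∈ C C⊆ i j j≢i = x∈p∧x≢y⇒x∈p-y (C⊆ j) (j≢i ∘ es-inj C)

    -- In a positive cycle the rest of the cycle joins the ends of an edge by a walk of the sign of
    -- that edge, so the edge is spanned by the others.
    basis-negative : ∀ C → CycleIn G U C → NegativeCycle G C
    basis-negative C C⊆ with sign (es C) in sg
    ... | true = sign⇒negative C sg
    ... | false with chain-cut (vs C) (es C) (chain C) zero (rest∈ C C⊆ zero)
    ... | x , y , s₁ , s₂ , j , p , q , eq = ⊥-elim (not-spanned (C⊆ zero) (x , y , j ,
            inj₁ (subst (λ σ → Walk (U - es C zero) σ x y) (lemma s₁ (neg (es C zero)) s₂ (trans (sym eq) sg)) (walk-sym (walk-trans q p)))))
      where
      lemma : ∀ a b c → a xor (b xor c) ≡ false → c xor a ≡ b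
      lemma true  true  false _ = refl
      lemma true  false true  _ = refl
      lemma false true  true  _ = refl
      lemma false false false _ = refl

    reroute : ∀ {e x y u v} → Joins G e x y → Conn G (U - e) x y → Conn G U u v → Conn G (U - e) u v
    reroute j x~y here = here
    reroute {e} j x~y (step f f∈ jf rest) with f Finₚ.≟ e
    ... | no f≢e = step f (x∈p∧x≢y⇒x∈p-y f∈ f≢e) jf (reroute j x~y rest)
    ... | yes refl with joins-unique j jf
    ... | inj₁ (refl , refl) = conn-trans x~y (reroute j x~y rest)
    ... | inj₂ (refl , refl) = conn-trans (conn-sym x~y) (reroute j x~y rest)

    -- Suppose an edge of `C` is not in `D`. Without it the rest of `C` still connects its ends, and
    -- the negative cycle `D` is still present in their component. Both ends are then unbalanced, so
    -- the edge would be spanned.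
    same-edges : ∀ v C D → CycleInCompOf G U v C → CycleInCompOf G U v D → ∀ {e} → _∈ₑ_ G e C → _∈ₑ_ G e D
    same-edges v C D (C⊆ , iC , v~C) (D⊆ , iD , v~D) (i , refl) with any? (λ j → es D j Finₚ.≟ es C i)
    ... | yes e∈D = e∈D
    ... | no e∉D with chain-cut (vs C) (es C) (chain C) i (rest∈ C C⊆ i)
    ... | x , y , s₁ , s₂ , j , p , q , _ = ⊥-elim (not-spanned (C⊆ i) (x , y , j , inj₂ (unb-x , unbalanced-conn (walk-sym y→x) unb-x)))
      where
      y→x = walk-trans q p
      C₀~D : Conn G U (vs C zero) (vs D iD)
      C₀~D = conn-trans (cycle-conn C C⊆ iC) (conn-trans (conn-sym v~C) v~D)
      unb-x : Unbalanced (U - es C i) x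
      unb-x = negative⇒unbalanced D
        ((λ k → x∈p∧x≢y⇒x∈p-y (D⊆ k) (λ eq → e∉D (k , eq))) , iD ,
          conn-trans (conn-sym (walk⇒conn p)) (reroute j (conn-sym (walk⇒conn y→x)) C₀~D))
        (basis-negative D D⊆)

    basis⇒unicyclic : SignedUnicyclic G U
    basis⇒unicyclic =
      (λ v → let (C , C∈ , _) = unbalanced⇒negative (b≡0⇒all-unbalanced b≡0 v) in C , C∈) ,
      (λ v C D C∈ D∈ e → mk⇔ (same-edges v C D C∈ D∈) (same-edges v D C D∈ C∈)) ,
      basis-negative
      where
      b≡0 : b U ≡ 0
      b≡0 = +-cancelˡ-≡ (rk U) _ _ (trans (rk+b U) (trans (sym rk-U) (sym (+-identityʳ _))))

-- Anti-Ramsey numbers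

argmax : ∀ {n} {P : Subset n → Set} → (∀ F → Dec (P F)) → (f : Subset n → ℕ) (M : ℕ) → (∀ F → f F ≤ M) → ∃ P →
  ∃ λ F → P F × (∀ F′ → P F′ → f F′ ≤ f F)
argmax {P = P} P? f M f≤M (F₀ , P₀) = go M F₀ P₀ (m≤m+n M _)
  where
  go : ∀ k F → P F → M ≤ k + f F → ∃ λ F → P F × (∀ F′ → P F′ → f F′ ≤ f F)
  go k F PF M≤ with anySubset? (λ F′ → P? F′ ×-dec (f F <? f F′))
  ... | no ¬better = F , PF , λ F′ PF′ → ≮⇒≥ λ lt → ¬better (F′ , PF′ , lt)
  go zero    F PF M≤ | yes (F′ , PF′ , lt) = ⊥-elim (<⇒≱ (<-≤-trans lt (f≤M F′)) M≤)
  go (suc k) F PF M≤ | yes (F′ , PF′ , lt) = go k F′ PF′ (≤-trans M≤ (≤-trans (≤-reflexive (sym (+-suc k (f F)))) (+-monoʳ-≤ k lt)))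

module AntiRamsey (G : SGraph) (t : ℕ) where
  open SGraph G renaming (n to order; m to size)
  open SignedWalks G
  open SignedGraphicMatroid G

  ∣⊤─∣ : ∀ F → ∣ ⊤ ─ F ∣ ≡ size ∸ ∣ F ∣
  ∣⊤─∣ F = trans (cong ∣_∣ (∁-─ F)) (∣∁p∣≡n∸∣p∣ F)

  colours≤size : ∀ {p} → Coloring G p → p ≤ size
  colours≤size (c , surj) = injective⇒≤ {f = proj₁ ∘ surj} λ {x} {y} eq →
    trans (sym (proj₂ (surj x))) (trans (cong c eq) (proj₂ (surj y)))

  -- With all colours distinct every subgraph is rainbow, and `t` disjoint unicyclic ones would need
  -- `t * b F` edges outside `F`.
  sparse⇒IsAr : ∀ F → size ∸ ∣ F ∣ < t * b F → IsAr G t size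
  sparse⇒IsAr F sparse = ((id , λ x → x , refl) , none) , λ p adm → colours≤size (proj₁ adm)
    where
    open ≤-Reasoning
    none : ¬ HasTDisjointRainbowSUS G id t
    none (U , su , disjoint) = <⇒≱ sparse (begin
      t * b F                        ≡⟨ sumᶠ-const t (b F) ⟨
      sumᶠ {t} (λ _ → b F)           ≤⟨ sumᶠ-mono-≤ (λ i → b≤∣unicyclic─∣ (proj₁ (su i)) F) ⟩
      sumᶠ (λ i → ∣ U i ─ F ∣)       ≤⟨ sumᶠ-disjoint≤∣∣ (⊤ ─ F) (λ i → U i ─ F)
                                          (λ i x∈ → x∈p∧x∉q⇒x∈p─q ∈⊤ (proj₂ (x∈p─q⁻ (U i) F x∈)))
                                          (λ i j x x∈i x∈j → disjoint i j x (p─q⊆p (U i) F x∈i) (p─q⊆p (U j) F x∈j)) ⟩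
      ∣ ⊤ ─ F ∣                      ≡⟨ ∣⊤─∣ F ⟩
      size ∸ ∣ F ∣                   ∎)

  -- A rainbow unicyclic subgraph has at most one edge outside A, hence at least b F ∸ 1 edges in A ─ F,
  -- and A ─ F is too small to contain t disjoint such sets.
  module Lower (F A : Subset size) (F⊆A : F ⊆ A) (∣A∣< : ∣ A ∣ < ∣ F ∣ + t * (b F ∸ 1)) (A<size : ∣ A ∣ < size) where

    colour : Fin size → Fin (suc ∣ A ∣)
    colour e with e ∈? A
    ... | yes e∈ = suc (∈-index A e∈)
    ... | no  _  = zero

    colour-∉ : ∀ {e} → e ∉ A → colour e ≡ zero
    colour-∉ {e} e∉ with e ∈? A
    ... | yes e∈ = ⊥-elim (e∉ e∈)
    ... | no  _  = refl

    colour-surjective : ∀ x → Σ (Fin size) λ e → colour e ≡ x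
    colour-surjective zero with any? (λ e → ¬? (e ∈? A))
    ... | yes (e , e∉) = e , colour-∉ e∉
    ... | no ¬e = ⊥-elim (<⇒≱ A<size (≤-trans (≤-reflexive (sym (∣⊤∣≡n size)))
                    (p⊆q⇒∣p∣≤∣q∣ {p = ⊤} {q = A} λ {e} _ → decidable-stable (e ∈? A) λ e∉ → ¬e (e , e∉))))
    colour-surjective (suc i) with ∈-index-surjective A i
    ... | e , e∈ , eq = e , colour-e
      where
      colour-e : colour e ≡ suc i
      colour-e with e ∈? A
      ... | yes e∈′ = cong suc (trans (cong (∈-index A) ([]=-irrelevant e∈′ e∈)) eq)
      ... | no e∉ = ⊥-elim (e∉ e∈)

    outside≤1 : ∀ U → Rainbow G colour U → ∣ U ─ A ∣ ≤ 1
    outside≤1 U rb = ∣∣-injection (U ─ A) (⊤ {1}) (λ _ → zero) (λ _ → ∈⊤) λ x∈ y∈ _ →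
      let (x∈U , x∉A) = x∈p─q⁻ U A x∈ ; (y∈U , y∉A) = x∈p─q⁻ U A y∈ in
      rb _ _ x∈U y∈U (trans (colour-∉ x∉A) (sym (colour-∉ y∉A)))

    none : ¬ HasTDisjointRainbowSUS G colour t
    none (U , su , disjoint) = <⇒≱ ∣A∣< (begin
      ∣ F ∣ + t * (b F ∸ 1)                  ≡⟨ cong (∣ F ∣ +_) (sumᶠ-const t (b F ∸ 1)) ⟨
      ∣ F ∣ + sumᶠ {t} (λ _ → b F ∸ 1)       ≤⟨ +-monoʳ-≤ ∣ F ∣ (sumᶠ-mono-≤ each) ⟩
      ∣ F ∣ + sumᶠ (λ i → ∣ U i ∩ (A ─ F) ∣) ≤⟨ +-mono-≤ (p⊆q⇒∣p∣≤∣q∣ λ x∈ → x∈p∩q⁺ (F⊆A x∈ , x∈))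
                                                  (sumᶠ-disjoint≤∣∣ (A ─ F) _ (λ i → p∩q⊆q (U i) (A ─ F))
                                                    λ i j x x∈i x∈j → disjoint i j x (p∩q⊆p (U i) _ x∈i) (p∩q⊆p (U j) _ x∈j)) ⟩
      ∣ A ∩ F ∣ + ∣ A ─ F ∣                  ≡⟨ ∣p∩q∣+∣p─q∣≡∣p∣ A F ⟩
      ∣ A ∣                                  ∎)
      where
      open ≤-Reasoning
      incl : ∀ i → U i ─ F ⊆ (U i ─ A) ∪ (U i ∩ (A ─ F))
      incl i {x} x∈ with x∈p─q⁻ (U i) F x∈ | x ∈? A
      ... | x∈U , x∉F | yes x∈A = q⊆p∪q (U i ─ A) _ (x∈p∩q⁺ (x∈U , x∈p∧x∉q⇒x∈p─q x∈A x∉F))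
      ... | x∈U , x∉F | no x∉A = p⊆p∪q _ (x∈p∧x∉q⇒x∈p─q x∈U x∉A)
      each : ∀ i → b F ∸ 1 ≤ ∣ U i ∩ (A ─ F) ∣
      each i = m≤n+o⇒m∸n≤o (b F) 1 (begin
        b F                                     ≤⟨ b≤∣unicyclic─∣ (proj₁ (su i)) F ⟩
        ∣ U i ─ F ∣                             ≤⟨ p⊆q⇒∣p∣≤∣q∣ (incl i) ⟩
        ∣ (U i ─ A) ∪ (U i ∩ (A ─ F)) ∣         ≤⟨ ∣p∪q∣≤∣p∣+∣q∣ (U i ─ A) _ ⟩
        ∣ U i ─ A ∣ + ∣ U i ∩ (A ─ F) ∣         ≤⟨ +-monoˡ-≤ _ (outside≤1 (U i) (proj₂ (su i))) ⟩
        1 + ∣ U i ∩ (A ─ F) ∣                   ∎)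

    admissible : Admissible G t (suc ∣ A ∣)
    admissible = (colour , colour-surjective) , none

  module Dense (1≤t : 1 ≤ t) (dense : ∀ F → t * b F ≤ size ∸ ∣ F ∣) where

    value : Subset size → ℕ
    value F = ∣ F ∣ + t * (b F ∸ 1)

    value≤size : ∀ F → value F ≤ size
    value≤size F = begin
      ∣ F ∣ + t * (b F ∸ 1)    ≤⟨ +-monoʳ-≤ ∣ F ∣ (≤-trans (*-monoʳ-≤ t (m∸n≤m (b F) 1)) (dense F)) ⟩
      ∣ F ∣ + (size ∸ ∣ F ∣)   ≡⟨ m+[n∸m]≡n (∣p∣≤n F) ⟩
      size                     ∎
      where
      open ≤-Reasoning

    -- The set `A` of privately coloured edges has size `value F ∸ 1`; the common colour supplies
    -- the last one. There is room for `F` in `A` because `t * (b F ∸ 1)` is positive, and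
    -- `value F ≤ size` leaves an edge for the common colour.
    value-admissible : ∀ F → 2 ≤ b F → Admissible G t (value F)
    value-admissible F 2≤b with value F in eq | superset-of-size F (value F ∸ 1)
                                  (m+n≤o⇒m≤o∸n ∣ F ∣ (+-monoʳ-≤ ∣ F ∣ (*-mono-≤ 1≤t (m+n≤o⇒m≤o∸n 1 2≤b))))
                                  (≤-trans (m∸n≤m (value F) 1) (value≤size F))
    ... | zero | _ = ⊥-elim (n≮0 (≤-trans (≤-trans (*-mono-≤ 1≤t (m+n≤o⇒m≤o∸n 1 2≤b)) (m≤n+m _ ∣ F ∣)) (≤-reflexive eq)))
    ... | suc a | A , F⊆A , ∣A∣≡a = subst (Admissible G t) (cong suc ∣A∣≡a)
            (Lower.admissible F A F⊆A (≤-reflexive (trans (cong suc ∣A∣≡a) (sym eq)))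
              (≤-trans (≤-reflexive (trans (cong suc ∣A∣≡a) (sym eq))) (value≤size F)))

    module Upper (q : ℕ) (order≡ : order ≡ suc q) (rank : rk ⊤ ≡ suc q) {p : ℕ} (colouring : Coloring G p)
      (p> : ∀ F → 2 ≤ b F → value F < p) where
      open Image (proj₁ colouring)

      rk+b≡1+q : ∀ F → rk F + b F ≡ suc q
      rk+b≡1+q F = trans (rk+b F) order≡

      p≤ : ∀ F → p ≤ ∣ F ∣ + ∣ image (⊤ ─ F) ∣
      p≤ F = begin
        p                                   ≡⟨ ∣⊤∣≡n p ⟨
        ∣ ⊤ {p} ∣                           ≤⟨ p⊆q⇒∣p∣≤∣q∣ {p = ⊤} (λ {x} _ → all-colours x) ⟩
        ∣ image F ∪ image (⊤ ─ F) ∣         ≤⟨ ∣p∪q∣≤∣p∣+∣q∣ (image F) _ ⟩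
        ∣ image F ∣ + ∣ image (⊤ ─ F) ∣     ≤⟨ +-monoˡ-≤ _ (∣image∣≤∣∣ F) ⟩
        ∣ F ∣ + ∣ image (⊤ ─ F) ∣           ∎
        where
        open ≤-Reasoning
        all-colours : ∀ x → x ∈ image F ∪ image (⊤ ─ F)
        all-colours x with proj₂ colouring x
        ... | e , refl with e ∈? F
        ... | yes e∈ = p⊆p∪q _ (∈-image⁺ e∈)
        ... | no e∉ = q⊆p∪q (image F) _ (∈-image⁺ (x∈p∧x∉q⇒x∈p─q ∈⊤ e∉))

      many-elements : ∀ F → t * suc q ≤ t * rk F + ∣ ⊤ ─ F ∣
      many-elements F = begin
        t * suc q                  ≡⟨ cong (t *_) (rk+b≡1+q F) ⟨
        t * (rk F + b F)           ≡⟨ *-distribˡ-+ t _ _ ⟩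
        t * rk F + t * b F         ≤⟨ +-monoʳ-≤ (t * rk F) (≤-trans (dense F) (≤-reflexive (sym (∣⊤─∣ F)))) ⟩
        t * rk F + ∣ ⊤ ─ F ∣       ∎
        where
        open ≤-Reasoning

      -- For corank 0 the term `t * rk F` suffices since `1 ≤ t`. For corank 1 a single colour
      -- outside `F` is missing, and density provides an edge there. Larger coranks are where the
      -- number of colours enters.
      many-colours-by-corank : ∀ F k → b F ≡ k → suc (t * q) ≤ t * rk F + ∣ image (⊤ ─ F) ∣
      many-colours-by-corank F zero eq = begin
        suc (t * q)                ≤⟨ +-monoˡ-≤ (t * q) 1≤t ⟩
        t + t * q                  ≡⟨ *-suc t q ⟨
        t * suc q                  ≡⟨ cong (t *_) (trans (sym (rk+b≡1+q F)) (trans (cong (rk F +_) eq) (+-identityʳ _))) ⟩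
        t * rk F                   ≤⟨ m≤m+n _ _ ⟩
        t * rk F + ∣ image (⊤ ─ F) ∣ ∎
        where
        open ≤-Reasoning
      many-colours-by-corank F (suc zero) eq = begin
        suc (t * q)                ≡⟨ +-comm 1 (t * q) ⟩
        t * q + 1                  ≡⟨ cong (λ z → t * z + 1) (suc-injective (trans (sym (rk+b≡1+q F)) (trans (cong (rk F +_) eq) (+-comm _ 1)))) ⟩
        t * rk F + 1               ≤⟨ +-monoʳ-≤ (t * rk F) (nonempty (nonempty? (⊤ ─ F))) ⟩
        t * rk F + ∣ image (⊤ ─ F) ∣ ∎
        where
        open ≤-Reasoning
        nonempty : Dec (Nonempty (⊤ ─ F)) → 1 ≤ ∣ image (⊤ ─ F) ∣
        nonempty (yes (e , e∈)) = ≤-trans (≤-reflexive (sym (∣⁅x⁆∣≡1 (proj₁ colouring e)))) (p⊆q⇒∣p∣≤∣q∣ (x∈p⇒⁅x⁆⊆p (∈-image⁺ e∈)))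
        nonempty (no ¬ne) = ⊥-elim (n≮0 (begin
          1                        ≤⟨ *-mono-≤ 1≤t (≤-reflexive (sym eq)) ⟩
          t * b F                  ≤⟨ dense F ⟩
          size ∸ ∣ F ∣             ≡⟨ ∣⊤─∣ F ⟨
          ∣ ⊤ ─ F ∣                ≡⟨ trans (cong ∣_∣ (Empty-unique ¬ne)) (∣⊥∣≡0 size) ⟩
          0                        ∎))
      -- Since `q` exceeds `rk F` by `b F ∸ 1`, adding `∣ F ∣` turns the target into
      -- `t * rk F + suc (value F)`, and `suc (value F) ≤ p` is bounded by `p≤`.
      many-colours-by-corank F (suc (suc k)) eq = +-cancelˡ-≤ ∣ F ∣ _ _ (begin
        ∣ F ∣ + suc (t * q)                                      ≡⟨ cong (λ z → ∣ F ∣ + suc (t * z)) q≡ ⟩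
        ∣ F ∣ + suc (t * (rk F + suc k))                         ≡⟨ shuffle₁ ∣ F ∣ t (rk F) (suc k) ⟩
        t * rk F + suc (∣ F ∣ + t * suc k)                       ≤⟨ +-monoʳ-≤ (t * rk F) (≤-trans (≤-reflexive (cong (λ z → suc (∣ F ∣ + t * (z ∸ 1))) (sym eq)))
                                                                      (≤-trans (p> F (≤-trans (s≤s (s≤s z≤n)) (≤-reflexive (sym eq)))) (p≤ F))) ⟩
        t * rk F + (∣ F ∣ + ∣ image (⊤ ─ F) ∣)                   ≡⟨ shuffle₂ (t * rk F) ∣ F ∣ _ ⟩
        ∣ F ∣ + (t * rk F + ∣ image (⊤ ─ F) ∣)                   ∎)
        where
        open ≤-Reasoning
        q≡ : q ≡ rk F + suc k
        q≡ = suc-injective (trans (sym (rk+b≡1+q F)) (trans (cong (rk F +_) eq) (+-suc _ _)))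
        shuffle₁ : ∀ f t r k → f + suc (t * (r + k)) ≡ t * r + suc (f + t * k)
        shuffle₁ = solve-∀
        shuffle₂ : ∀ a b c → a + (b + c) ≡ b + (a + c)
        shuffle₂ = solve-∀

      many-colours : ∀ F → suc (t * q) ≤ t * rk F + ∣ image (⊤ ─ F) ∣
      many-colours F = many-colours-by-corank F (b F) refl

      open RainbowBases rk rk-isRankFunction q rank (proj₁ colouring) t

      packing⇒unicyclic : RainbowPacking → HasTDisjointRainbowSUS G (proj₁ colouring) t
      packing⇒unicyclic (B , bases , disjoint) = B , (λ i →
          basis⇒unicyclic (trans (proj₁ (proj₁ (bases i))) (sym order≡)) (trans (proj₂ (proj₁ (bases i))) (sym order≡)) , proj₂ (bases i)) ,
        disjoint

      packing : HasTDisjointRainbowSUS G (proj₁ colouring) t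
      packing = packing⇒unicyclic (rainbow-packing many-colours many-elements)

theorem16 : (G : SGraph) → Connected G → 2 ≤ SGraph.n G → HasNegativeCycle G →
    (t : ℕ) → 1 ≤ t →
    ((Σ (EdgeSet G) λ F₀ → Σ ℕ λ k → BCount G F₀ k × SGraph.m G ∸ ∣ F₀ ∣ < t * k)
    → IsAr G t (SGraph.m G))
    × (¬ (Σ (EdgeSet G) λ F₀ → Σ ℕ λ k → BCount G F₀ k × SGraph.m G ∸ ∣ F₀ ∣ < t * k)
    → Σ ℕ λ X → IsMaxFormula G t X × IsAr G t X)
theorem16 G connected 2≤n (C , neg-C) t 1≤t = sparse-case , dense-case
  where
  open SignedWalks G
  open Cycles G
  open SignedGraphicMatroid G
  open AntiRamsey G t

  sparse-case : _
  sparse-case (F₀ , k , bc , lt) = sparse⇒IsAr F₀ (subst (λ z → SGraph.m G ∸ ∣ F₀ ∣ < t * z) (BCount-unique bc (bcount F₀)) lt)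

  -- Connectedness puts every vertex into the component of the given negative cycle.
  rk-⊤ : rk ⊤ ≡ SGraph.n G
  rk-⊤ = cong (SGraph.n G ∸_) (all-unbalanced⇒b≡0 λ v → negative⇒unbalanced C ((λ _ → ∈⊤) , zero , connected v _) neg-C)

  dense-case : _
  -- The empty edge set is a candidate, as its `n ≥ 2` isolated vertices are balanced components.
  dense-case ¬sparse with argmax (λ F → 2 ≤? b F) value (SGraph.m G) value≤size (⊥ , ≤-trans 2≤n (≤-reflexive (sym b-⊥)))
    where
    open Dense 1≤t (λ F → ≮⇒≥ λ lt → ¬sparse (F , b F , bcount F , lt))
  ... | F , 2≤b , maximal = value F , ((F , b F , bcount F , 2≤b , refl) , max-bound) , value-admissible F 2≤b , upper
    where
    open Dense 1≤t (λ F → ≮⇒≥ λ lt → ¬sparse (F , b F , bcount F , lt))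
    max-bound : ∀ F′ k → BCount G F′ k → 2 ≤ k → ∣ F′ ∣ + t * (k ∸ 1) ≤ value F
    max-bound F′ k bc 2≤k with refl ← BCount-unique bc (bcount F′) = maximal F′ 2≤k
    upper : ∀ p → Admissible G t p → p ≤ value F
    upper p (colouring , none) with p ≤? value F
    ... | yes p≤ = p≤
    ... | no p≰ = ⊥-elim (none (Upper.packing (SGraph.n G ∸ 1) n≡ (trans rk-⊤ n≡) colouring λ F′ 2≤b′ → ≤-<-trans (maximal F′ 2≤b′) (≰⇒> p≰)))
      where
      n≡ : SGraph.n G ≡ suc (SGraph.n G ∸ 1)
      n≡ = sym (m+[n∸m]≡n (≤-trans (s≤s z≤n) 2≤n))
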